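{- Let $m\geqslant 3$ be an odd integer. Then the number of distinct $C_4$-face-magic projective labelings on $\mathcal{P}_{m,m}$ with $C_4$-face-magic value $2m^2+1$, counted up to symmetries of the projective plane, is at least $\tau(m,m)\,2^{m-3}\,\bigl(\beta(m)\bigr)^2$; the same lower bound holds for those with $C_4$-face-magic value $2m^2+3$.
   Context: $\mathcal{P}_{m,n}$ has vertices $(i,j)$, $1\leqslant i\leqslant m$, $1\leqslant j\leqslant n$, and edges $(i,j)$–$(i,j+1)$ ($j\leqslant n-1$), $(i,n)$–$(m+1-i,1)$, $(i,j)$–$(i+1,j)$ ($i\leqslant m-1$), $(m,j)$–$(1,n+1-j)$, embedded naturally in the projective plane. Its 4-cycle faces are $\{(i,j),(i+1,j),(i,j+1),(i+1,j+1)\}$ ($1\leqslant i\leqslant m-1$, $1\leqslant j\leqslant n-1$), $\{(i,n),(i+1,n),(m+1-i,1),(m-i,1)\}$ ($1\leqslant i\leqslant m-1$), $\{(m,j),(m,j+1),(1,n+1-j),(1,n-j)\}$ ($1\leqslant j\leqslant n-1$); the other two faces are digons. A $C_4$-face-magic projective labeling is a bijection from the vertices onto $\{1,\ldots,mn\}$ such that every 4-cycle face has the same label sum, the $C_4$-face-magic value. For $\mathcal{P}_{m,m}$ the symmetries are the 8 elements of the dihedral group generated by the rotation $(i,j)\mapsto(m+1-j,i)$ and the reflection $(i,j)\mapsto(i,m+1-j)$ about the center vertex; labelings are counted up to precomposition with these. For positive integer $k$, an $(m,n)$-projective factorization sequence is a tuple $(m_1,n_1,\ldots,m_k,n_k)$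 of integers $>1$ with $m=m_1\cdots m_k$, $n=n_1\cdots n_k$, or a tuple $(m_1,n_1,\ldots,m_k,n_k,m_{k+1})$ of integers $>1$ with $m=m_1\cdots m_{k+1}$, $n=n_1\cdots n_k$; $\tau(m,n)$ is the number of distinct such sequences. For odd $m\geqslant3$, $\beta(m)=\bigl((\tfrac{m-1}{4})!\bigr)^2$ if $m\equiv1\pmod4$ and $\beta(m)=(\tfrac{m-3}{4})!\,(\tfrac{m+1}{4})!$ if $m\equiv3\pmod4$. -}

module Defs where

open import Data.Nat using (ℕ; zero; suc; _+_; _*_; _∸_; _^_; _≤_; _<_; _<?_)
open import Data.Nat.DivMod using (_/_; _%_)
open import Data.Nat using (_!)
open import Data.Nat.ListAction using (product)
open import Data.Fin using (Fin; toℕ; fromℕ<)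
open import Data.Bool using (Bool; true; false; if_then_else_)
open import Data.Product using (_×_; _,_; Σ; ∃; proj₁; proj₂)
open import Data.List using (List; []; _∷_; length)
open import Data.List.Relation.Unary.All using (All)
open import Data.Nat using (_≟_)
open import Function using (_∘_)
open import Function.Bundles using (Bijection; _⤖_)
open import Relation.Nullary using (¬_; yes; no)
open import Relation.Binary.PropositionalEquality using (_≡_)

-- Labelings of the projective grid graph P_{m,n}.
-- Vertices (i,j), 1 ≤ i ≤ m, 1 ≤ j ≤ n, are represented by
-- Fin m × Fin n via (i,j) ↦ (i-1, j-1); a labeling is a bijection onto
-- {1,…,mn}, represented as a bijection onto Fin (m*n) (label = 1 + index).

Labeling : ℕ → ℕ → Set
Labeling m n = (Fin m × Fin n) ⤖ Fin (m * n)

-- The label of the 1-indexed vertex (i,j); 0 outside the vertex range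
-- (never used for in-range vertices).
at : {m n : ℕ} → Labeling m n → ℕ → ℕ → ℕ
at {m} {n} L i j with i ∸ 1 <? m | j ∸ 1 <? n
... | yes p | yes q = suc (toℕ (Bijection.to L (fromℕ< p , fromℕ< q)))
... | _     | _     = 0

FaceMagic : {m n : ℕ} → Labeling m n → ℕ → Set
FaceMagic {m} {n} L s =
    (∀ i j → 1 ≤ i → i ≤ m ∸ 1 → 1 ≤ j → j ≤ n ∸ 1 →
       at L i j + at L (i + 1) j + at L i (j + 1) + at L (i + 1) (j + 1) ≡ s)
  × (∀ i → 1 ≤ i → i ≤ m ∸ 1 →
       at L i n + at L (i + 1) n + at L (m + 1 ∸ i) 1 + at L (m ∸ i) 1 ≡ s)
  × (∀ j → 1 ≤ j → j ≤ n ∸ 1 →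
       at L m j + at L m (j + 1) + at L 1 (n + 1 ∸ j) + at L 1 (n ∸ j) ≡ s)

-- Symmetries of P_{m,m}: the dihedral group of order 8 generated by the
-- rotation (i,j) ↦ (m+1-j, i) and the reflection (i,j) ↦ (i, m+1-j)
-- (1-indexed coordinates). Element (k , b) is rot^k ∘ refl^b.

rot : ℕ → ℕ × ℕ → ℕ × ℕ
rot m (i , j) = (m + 1 ∸ j , i)

refl : ℕ → ℕ × ℕ → ℕ × ℕ
refl m (i , j) = (i , m + 1 ∸ j)

rotPow : ℕ → ℕ → ℕ × ℕ → ℕ × ℕ
rotPow m zero    v = v
rotPow m (suc k) v = rot m (rotPow m k v)

sym : ℕ → Fin 4 × Bool → ℕ × ℕ → ℕ × ℕ
sym m (k , b) v = rotPow m (toℕ k) (if b then refl m v else v)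

Equivalent : {m : ℕ} → Labeling m m → Labeling m m → Set
Equivalent {m} L L′ =
  ∃ λ (g : Fin 4 × Bool) → ∀ i j → 1 ≤ i → i ≤ m → 1 ≤ j → j ≤ m →
    at L′ i j ≡ at L (proj₁ (sym m g (i , j))) (proj₂ (sym m g (i , j)))

-- Projective factorization sequences, as lists
-- [m₁, n₁, m₂, n₂, …] (length 2k) or [m₁, n₁, …, m_k, n_k, m_{k+1}]
-- (length 2k+1), k ≥ 1: entries at even positions are the mᵢ,
-- entries at odd positions are the nᵢ.

evens : List ℕ → List ℕ
odds  : List ℕ → List ℕ
evens []       = []
evens (x ∷ xs) = x ∷ odds xs
odds  []       = []
odds  (x ∷ xs) = evens xs

IsProjFactSeq : ℕ → ℕ → List ℕ → Set
IsProjFactSeq m n xs =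
  2 ≤ length xs × All (λ x → 2 ≤ x) xs
  × product (evens xs) ≡ m × product (odds xs) ≡ n

β : ℕ → ℕ
β m with m % 4 ≟ 1
... | yes _ = ((m ∸ 1) / 4) ! * ((m ∸ 1) / 4) !
... | no  _ = ((m ∸ 3) / 4) ! * ((m + 1) / 4) !

{-# OPTIONS --safe #-}
module Submission where

-- Write m = 2h + 1.  If V(i,j) = α(i) + β(j) is a bijection from the cells onto
-- {0,…,m²-1}, where V(i,j) ≡ i + j mod 2 and α, β are antisymmetric about the
-- centre up to a constant, then V can be turned into a labeling by giving the
-- label ⌊V/2⌋ + 1 to the cells of one parity and m² - ⌊V/2⌋ to the others.  On
-- every face the two diagonals have opposite parities and the same sum of V,
-- which makes the labeling magic, of value 2m² + 3 or 2m² + 1 according to the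
-- parity chosen.
--
-- A factorization sequence, read as a list of radices, yields such α and β in
-- increasing order: α takes the numbers supported on the even digits, β those
-- supported on the odd digits.  All radices are odd, so these enumerations
-- preserve parity.  They may be rearranged by any parity preserving permutation
-- of the positions commuting with the reflection about the centre; there are
-- 2^h β(m) of these, and 2^(h-1) β(m) up to that reflection.  An equivalence of
-- two labelings permutes the values of α and β up to reflections, hence
-- preserves the increasing enumerations, from which the radices are read off;
-- it cannot exchange α and β because only α takes the value 1.

open import Defs hiding (sym; refl)
import Defs
open import Data.Nat
open import Data.Nat.Properties
open import Data.Nat.DivMod
open import Data.Nat.Induction using (<-rec)
open import Data.Nat.ListAction using (product)
open import Data.Nat.Tactic.RingSolver using (solve-∀)
open import Data.Bool using (Bool; true; false; not)
open import Data.Empty using (⊥-elim)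
open import Data.Fin as Fin using (Fin; toℕ; fromℕ<)
import Data.Fin.Properties as Fin
open import Data.List using (List; []; _∷_; length; lookup)
open import Data.List.Membership.Propositional using (_∈_)
open import Data.List.Membership.Propositional.Properties using (∈-lookup)
open import Data.List.Relation.Unary.All as All using (All; []; _∷_)
open import Data.List.Relation.Unary.AllPairs using ([]; _∷_)
open import Data.List.Relation.Unary.Unique.Propositional using (Unique)
open import Data.Parity.Base as ℙ using (Parity; 0ℙ; 1ℙ)
import Data.Parity.Properties as ℙ
open import Data.Product using (_×_; _,_; Σ; ∃; proj₁; proj₂)
open import Data.Product.Function.NonDependent.Propositional using (_×-↣_)
open import Data.Sum using (_⊎_; inj₁; inj₂)
open import Data.Unit using (⊤; tt)
open import Data.Vec using (Vec; []; _∷_)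
open import Function using (Injective; Inverse; Injection; Equivalence; _⇔_; _↣_; mk↣; mk⤖; _∘_)
open import Function.Construct.Composition using (_↣-∘_)
open import Function.Construct.Identity using (↣-id)
open import Function.Properties.Inverse using (↔⇒↣)
open import Relation.Nullary using (¬_; yes; no; contradiction)
open import Relation.Binary.Definitions using (tri<; tri≈; tri>)
open import Relation.Binary.PropositionalEquality

-- Mixed radix enumerations

AllGE2 : List ℕ → Set
AllGE2 = All (2 ≤_)

digits-unique : ∀ x {r r′ a a′} → r < x → r′ < x →
  r + x * a ≡ r′ + x * a′ → r ≡ r′ × a ≡ a′
digits-unique x@(suc _) {r} {r′} {a} {a′} r<x r′<x eq = r≡r′ , a≡a′
  where
  rem : ∀ {r} a → r < x → (r + x * a) % x ≡ r
  rem {r} a r<x = trans (cong (λ t → (r + t) % x) (*-comm x a))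
    (trans ([m+kn]%n≡m%n r a x) (m<n⇒m%n≡m r<x))
  r≡r′ : r ≡ r′
  r≡r′ = trans (sym (rem a r<x)) (trans (cong (_% x) eq) (rem a′ r′<x))
  a≡a′ : a ≡ a′
  a≡a′ = *-cancelˡ-≡ a a′ x
    (+-cancelˡ-≡ r _ _ (trans eq (cong (_+ x * a′) (sym r≡r′))))

div-mod : ∀ k x .{{_ : NonZero x}} → k ≡ k % x + x * (k / x)
div-mod k x = trans (m≡m%n+[m/n]*n k x) (cong (k % x +_) (*-comm (k / x) x))

[r+x*a]%x≡r : ∀ x .{{_ : NonZero x}} {r} a → r < x → (r + x * a) % x ≡ r
[r+x*a]%x≡r x {r} a r<x = proj₁
  (digits-unique x (m%n<n (r + x * a) x) r<x (sym (div-mod (r + x * a) x)))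

[r+x*a]/x≡a : ∀ x .{{_ : NonZero x}} {r} a → r < x → (r + x * a) / x ≡ a
[r+x*a]/x≡a x {r} a r<x = proj₂
  (digits-unique x (m%n<n (r + x * a) x) r<x (sym (div-mod (r + x * a) x)))

r+x*a<x*n : ∀ x {r a n} → r < x → a < n → r + x * a < x * n
r+x*a<x*n x {r} {a} {n} r<x a<n = begin-strict
  r + x * a  <⟨ +-monoˡ-< (x * a) r<x ⟩
  x + x * a  ≡⟨ *-suc x a ⟨
  x * suc a  ≤⟨ *-monoʳ-≤ x a<n ⟩
  x * n      ∎
  where open ≤-Reasoning

k/x<n : ∀ x .{{_ : NonZero x}} {k n} → k < x * n → k / x < n
k/x<n x {k} {n} k<xn = m<n*o⇒m/o<n (subst (k <_) (*-comm x n) k<xn)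

-- rowVal xs and colVal xs enumerate increasingly the numbers whose mixed radix
-- digits (radices xs, least significant first) vanish at the odd, respectively
-- even, places.  The last digit is left unbounded, so that both enumerations
-- are strictly increasing on all of ℕ; only the arguments below
-- product (evens xs) and product (odds xs) matter.
rowVal colVal : List ℕ → ℕ → ℕ
rowVal []           k = k
rowVal (zero  ∷ xs) k = k
rowVal (suc x ∷ xs) k = k % suc x + suc x * colVal xs (k / suc x)
colVal []       k = k
colVal (x ∷ xs) k = x * rowVal xs k

rowVal-0 : ∀ xs → rowVal xs 0 ≡ 0
colVal-0 : ∀ xs → colVal xs 0 ≡ 0
rowVal-0 []           = refl
rowVal-0 (zero  ∷ xs) = refl
rowVal-0 (suc x ∷ xs) rewrite colVal-0 xs = *-zeroʳ (suc x)
colVal-0 []       = refl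
colVal-0 (x ∷ xs) rewrite rowVal-0 xs = *-zeroʳ x

rowVal-1 : ∀ {xs} → AllGE2 xs → rowVal xs 1 ≡ 1
rowVal-1 []                           = refl
rowVal-1 {suc x ∷ xs} (2≤x ∷ _) rewrite m<n⇒m%n≡m 2≤x | m<n⇒m/n≡0 2≤x | colVal-0 xs =
  cong suc (*-zeroʳ (suc x))

colVal-1 : ∀ {x xs} → AllGE2 xs → colVal (x ∷ xs) 1 ≡ x
colVal-1 {x} ge rewrite rowVal-1 ge = *-identityʳ x

StrictMono : (ℕ → ℕ) → Set
StrictMono f = ∀ {k l} → k < l → f k < f l

-- If the quotients by `x` differ, they decide the order, since a remainder is less than `x`; if
-- they agree, the remainders decide.
rowVal-mono : ∀ {xs} → AllGE2 xs → StrictMono (rowVal xs)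
colVal-mono : ∀ {xs} → AllGE2 xs → StrictMono (colVal xs)
rowVal-mono [] k<l = k<l
rowVal-mono {x@(suc _) ∷ xs} (_ ∷ ge) {k} {l} k<l with <-cmp (k / x) (l / x)
... | tri< lt _ _ = <-≤-trans (r+x*a<x*n x (m%n<n k x) (colVal-mono ge lt)) (m≤n+m _ (l % x))
... | tri≈ _ eq _ = subst (λ t → k % x + x * colVal xs t < rowVal (x ∷ xs) l) (sym eq)
  (+-monoˡ-< (x * colVal xs (l / x))
    (+-cancelʳ-< (x * (l / x)) (k % x) (l % x)
      (subst₂ _<_ (trans (div-mod k x) (cong (λ t → k % x + x * t) eq)) (div-mod l x) k<l)))
... | tri> _ _ gt = contradiction (/-monoˡ-≤ x (<⇒≤ k<l)) (<⇒≱ gt)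
colVal-mono [] k<l = k<l
colVal-mono {suc x ∷ xs} (_ ∷ ge) k<l = *-monoʳ-< (suc x) (rowVal-mono ge k<l)

regroup : ∀ r x a b → r + x * a + x * b ≡ r + x * (b + a)
regroup = solve-∀

regroup-product : ∀ x a b → x * (b * a) ≡ x * a * b
regroup-product = solve-∀

-- `regroup` writes the sum as `i % x` plus `x` times a sum of the same kind for the tail, in which
-- `j` has become the row index and `i / x` the column index. The induction exchanges the two
-- indices at each radix.
val-bound : ∀ {xs} → AllGE2 xs → ∀ {i j} → i < product (evens xs) → j < product (odds xs) →
  rowVal xs i + colVal xs j < product (evens xs) * product (odds xs)
val-bound [] {zero} {zero} _ _ = s≤s z≤n
val-bound [] {suc i} (s≤s ()) _
val-bound [] {zero} {suc j} _ (s≤s ())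
val-bound {x@(suc _) ∷ xs} (_ ∷ ge) {i} {j} i< j< = subst₂ _<_
  (sym (regroup (i % x) x (colVal xs (i / x)) (rowVal xs j)))
  (regroup-product x (product (odds xs)) (product (evens xs)))
  (r+x*a<x*n x (m%n<n i x) (val-bound ge j< (k/x<n x i<)))

val-injective : ∀ {xs} → AllGE2 xs → ∀ {i i′ j j′} →
  i < product (evens xs) → i′ < product (evens xs) →
  j < product (odds xs) → j′ < product (odds xs) →
  rowVal xs i + colVal xs j ≡ rowVal xs i′ + colVal xs j′ → i ≡ i′ × j ≡ j′
val-injective [] (s≤s z≤n) (s≤s z≤n) (s≤s z≤n) (s≤s z≤n) _ = refl , refl
val-injective {x@(suc _) ∷ xs} (_ ∷ ge) {i} {i′} {j} {j′} i< i′< j< j′< eq =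
  let r≡ , rest = digits-unique x (m%n<n i x) (m%n<n i′ x)
        (trans (sym (regroup (i % x) x (colVal xs (i / x)) (rowVal xs j)))
          (trans eq (regroup (i′ % x) x (colVal xs (i′ / x)) (rowVal xs j′))))
      j≡ , q≡ = val-injective ge j< j′< (k/x<n x i<) (k/x<n x i′<) rest
  in trans (div-mod i x) (trans (cong₂ (λ r q → r + x * q) r≡ q≡) (sym (div-mod i′ x))) , j≡

-- Complementary indices and carries

add-digits : ∀ r r′ x q q′ → (r + x * q) + (r′ + x * q′) ≡ r + r′ + x * (q + q′)
add-digits = solve-∀

-- The right side has the largest possible last digit `x`. A carry would leave the last digit `u`,
-- which is less than `x` because `r` and `r′` are at most `x`.
no-carry : ∀ x {r r′ q n} → r < suc x → r′ < suc x → r + r′ + suc x * q ≡ x + suc x * n →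
  r + r′ ≡ x × q ≡ n
no-carry x {r} {r′} {q} {n} r< r′< eq with r + r′ <? suc x
... | yes lt = digits-unique (suc x) lt ≤-refl eq
... | no ≮   = contradiction x≡ (<⇒≢ u<x)
  where
  u = r + r′ ∸ suc x
  u+ : u + suc x ≡ r + r′
  u+ = m∸n+n≡m (≮⇒≥ ≮)
  u<x : u < x
  u<x = +-cancelʳ-< (suc x) u x (subst (_< x + suc x) (sym u+) (+-mono-≤-< (s≤s⁻¹ r<) r′<))
  x≡ : u ≡ x
  x≡ = proj₁ (digits-unique (suc x) {a = suc q} (m<n⇒m<1+n u<x) ≤-refl
    (trans (trans (trans (cong (u +_) (*-suc (suc x) q)) (sym (+-assoc u (suc x) _)))
      (cong (_+ suc x * q) u+)) eq))

-- The sum `i + i′` is one less than a multiple of `suc x`, so its last digit is `x` and `no-carry`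
-- applies. The quotients satisfy an equation of the same kind, which keeps the recursion over the
-- radices going.
digit-complement : ∀ x i i′ {n} → suc (i + i′) ≡ suc x * n →
  i % suc x + i′ % suc x ≡ x × suc (i / suc x + i′ / suc x) ≡ n × i + i′ ≡ x + suc x * (i / suc x + i′ / suc x)
digit-complement x i i′ {zero} eq = contradiction (trans eq (*-zeroʳ (suc x))) λ ()
digit-complement x i i′ {suc n} eq = r≡ , cong suc q≡ , trans i+i′ (cong (_+ suc x * (i / suc x + i′ / suc x)) r≡)
  where
  i+i′ : i + i′ ≡ i % suc x + i′ % suc x + suc x * (i / suc x + i′ / suc x)
  i+i′ = trans (cong₂ _+_ (div-mod i (suc x)) (div-mod i′ (suc x)))
    (add-digits (i % suc x) (i′ % suc x) (suc x) (i / suc x) (i′ / suc x))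
  both = no-carry x {n = n} (m%n<n i (suc x)) (m%n<n i′ (suc x))
    (trans (sym i+i′) (suc-injective (trans eq (*-suc (suc x) n))))
  r≡ = proj₁ both
  q≡ = proj₂ both

-- Adding an index to its mirror image produces no carries.
rowVal-mirror : ∀ {xs} → AllGE2 xs → ∀ i i′ → suc (i + i′) ≡ product (evens xs) →
  rowVal xs i + rowVal xs i′ ≡ rowVal xs (i + i′)
colVal-mirror : ∀ {xs} → AllGE2 xs → ∀ i i′ → suc (i + i′) ≡ product (odds xs) →
  colVal xs i + colVal xs i′ ≡ colVal xs (i + i′)
rowVal-mirror [] _ _ _ = refl
rowVal-mirror {suc x ∷ xs} (_ ∷ ge) i i′ eq with digit-complement x i i′ eq
... | r≡ , q≡ , sum≡ = begin
  i % y + y * colVal xs (i / y) + (i′ % y + y * colVal xs (i′ / y))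
    ≡⟨ add-digits (i % y) (i′ % y) y (colVal xs (i / y)) (colVal xs (i′ / y)) ⟩
  i % y + i′ % y + y * (colVal xs (i / y) + colVal xs (i′ / y))
    ≡⟨ cong₂ (λ r q → r + y * q) r≡ (colVal-mirror ge (i / y) (i′ / y) q≡) ⟩
  x + y * colVal xs (i / y + i′ / y)
    ≡⟨ cong₂ (λ r q → r + y * colVal xs q) ([r+x*a]%x≡r y (i / y + i′ / y) ≤-refl) ([r+x*a]/x≡a y (i / y + i′ / y) ≤-refl) ⟨
  rowVal (y ∷ xs) (x + y * (i / y + i′ / y))
    ≡⟨ cong (rowVal (y ∷ xs)) sum≡ ⟨
  rowVal (y ∷ xs) (i + i′) ∎
  where
  open ≡-Reasoning
  y = suc x
colVal-mirror [] _ _ _ = refl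
colVal-mirror {x ∷ xs} (_ ∷ ge) i i′ eq =
  trans (sym (*-distribˡ-+ x (rowVal xs i) (rowVal xs i′))) (cong (x *_) (rowVal-mirror ge i i′ eq))

-- Parity of the enumerations

Odd : ℕ → Set
Odd n = parity n ≡ 1ℙ

odd-factors : ∀ x y → Odd (x * y) → Odd x × Odd y
odd-factors x y eq with parity x | parity y | trans (sym (ℙ.*-homo-* x y)) eq
... | 1ℙ | 1ℙ | _  = refl , refl

odd-entries : ∀ xs → Odd (product (evens xs)) → Odd (product (odds xs)) → All Odd xs
odd-entries []       _  _  = []
odd-entries (x ∷ xs) oe oo with odd-factors x (product (odds xs)) oe
... | ox , ooxs = ox ∷ odd-entries xs oo ooxs

odd-*-parity : ∀ x k → Odd x → parity (x * k) ≡ parity k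
odd-*-parity x k ox = trans (ℙ.*-homo-* x k) (cong (ℙ._* parity k) ox)

-- With odd radices every place value is odd, so modulo 2 both sides are the sum of the same digits.
rowVal-parity : ∀ {xs} → All Odd xs → ∀ k → parity (rowVal xs k) ≡ parity k
colVal-parity : ∀ {xs} → All Odd xs → ∀ k → parity (colVal xs k) ≡ parity k
rowVal-parity [] k = refl
rowVal-parity {x@(suc _) ∷ xs} (ox ∷ os) k = begin
  parity (k % x + x * colVal xs (k / x))          ≡⟨ ℙ.+-homo-+ (k % x) _ ⟩
  parity (k % x) ℙ.+ parity (x * colVal xs (k / x)) ≡⟨ cong (parity (k % x) ℙ.+_) same ⟩
  parity (k % x) ℙ.+ parity (x * (k / x))         ≡⟨ ℙ.+-homo-+ (k % x) _ ⟨
  parity (k % x + x * (k / x))                    ≡⟨ cong parity (div-mod k x) ⟨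
  parity k                                        ∎
  where
  open ≡-Reasoning
  same : parity (x * colVal xs (k / x)) ≡ parity (x * (k / x))
  same = trans (odd-*-parity x (colVal xs (k / x)) ox)
    (trans (colVal-parity os (k / x)) (sym (odd-*-parity x (k / x) ox)))
colVal-parity [] k = refl
colVal-parity {x ∷ xs} (ox ∷ os) k = trans (odd-*-parity x (rowVal xs k) ox) (rowVal-parity os k)

evens≥1 : ∀ {xs} → AllGE2 xs → 1 ≤ product (evens xs)
odds≥1  : ∀ {xs} → AllGE2 xs → 1 ≤ product (odds xs)
evens≥1 []         = s≤s z≤n
evens≥1 (2≤x ∷ ge) = *-mono-≤ (<⇒≤ 2≤x) (odds≥1 ge)
odds≥1 []          = s≤s z≤n
odds≥1 (_ ∷ ge)    = evens≥1 ge

evens≥2 : ∀ {x xs} → AllGE2 (x ∷ xs) → 2 ≤ product (evens (x ∷ xs))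
evens≥2 (2≤x ∷ ge) = *-mono-≤ 2≤x (odds≥1 ge)

-- The first radix x is read off as colVal (x ∷ xs) 1, or as the whole product
-- when no index 1 is available.
vals-determine : ∀ {xs ys} → AllGE2 xs → AllGE2 ys →
  product (evens xs) ≡ product (evens ys) → product (odds xs) ≡ product (odds ys) →
  (∀ k → k < product (evens xs) → rowVal xs k ≡ rowVal ys k) →
  (∀ k → k < product (odds xs) → colVal xs k ≡ colVal ys k) → xs ≡ ys
vals-determine [] [] _ _ _ _ = refl
vals-determine [] gy@(_ ∷ _) e _ _ _ = contradiction e (<⇒≢ (evens≥2 gy))
vals-determine gx@(_ ∷ _) [] e _ _ _ = contradiction (sym e) (<⇒≢ (evens≥2 gx))
vals-determine {x ∷ []} {y ∷ []} _ _ e _ _ _ =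
  cong (_∷ []) (trans (sym (*-identityʳ x)) (trans e (*-identityʳ y)))
vals-determine {x ∷ []} {y ∷ _ ∷ _} _ (_ ∷ gy) _ o _ _ = contradiction o (<⇒≢ (evens≥2 gy))
vals-determine {x ∷ _ ∷ _} {y ∷ []} (_ ∷ gx) _ _ o _ _ = contradiction (sym o) (<⇒≢ (evens≥2 gx))
vals-determine {x@(suc _) ∷ xs@(_ ∷ _)} {y ∷ ys@(_ ∷ _)} (2≤x ∷ gx) (2≤y ∷ gy) e o rows cols
  with trans (sym (colVal-1 {x} gx)) (trans (cols 1 (evens≥2 gx)) (colVal-1 {y} gy))
... | refl = cong (x ∷_) (vals-determine gx gy o (*-cancelˡ-≡ _ _ x e)
  (λ k k< → *-cancelˡ-≡ _ _ x (cols k k<))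
  (λ k k< → *-cancelˡ-≡ _ _ x
    (trans (sym (at-multiple xs k)) (trans (rows (x * k) (*-monoʳ-< x k<)) (at-multiple ys k)))))
  where
  -- At a multiple of `x` the last digit vanishes, so the row values there reveal the column values
  -- of the tail.
  at-multiple : ∀ zs k → rowVal (x ∷ zs) (x * k) ≡ x * colVal zs k
  at-multiple zs k = cong₂ (λ r q → r + x * colVal zs q)
    ([r+x*a]%x≡r x k (s≤s z≤n)) ([r+x*a]/x≡a x k (s≤s z≤n))

-- Permutations of an initial segment

-- Pigeonhole: if `y` were missed, punching it out would inject `Fin (suc n)` into `Fin n`.
fin-injective⇒surjective : ∀ {n} {f : Fin n → Fin n} → Injective _≡_ _≡_ f → ∀ y → ∃ λ x → f x ≡ y
fin-injective⇒surjective {suc n} {f} inj y with Fin.any? (λ x → f x Fin.≟ y)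
... | yes found = found
... | no ¬found = contradiction (Fin.injective⇒≤ {f = squeeze} squeeze-inj) 1+n≰n
  where
  avoid : ∀ x → y ≢ f x
  avoid x y≡fx = ¬found (x , sym y≡fx)
  squeeze : Fin (suc n) → Fin n
  squeeze x = Fin.punchOut (avoid x)
  squeeze-inj : Injective _≡_ _≡_ squeeze
  squeeze-inj {x} {x′} eq = inj (Fin.punchOut-injective (avoid x) (avoid x′) eq)

-- A function on all of ℕ, constrained only below `n`, composes directly with `rowVal` and `colVal`.
-- Surjectivity follows by finiteness.
record IsPerm (n : ℕ) (p : ℕ → ℕ) : Set where
  field
    bounded   : ∀ {i} → i < n → p i < n
    injective : ∀ {i j} → i < n → j < n → p i ≡ p j → i ≡ j

  surjective : ∀ {y} → y < n → ∃ λ x → x < n × p x ≡ y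
  surjective {y} y<n = toℕ x , Fin.toℕ<n x ,
    trans (sym (Fin.toℕ-fromℕ< _)) (trans (cong toℕ fx≡y) (Fin.toℕ-fromℕ< y<n))
    where
    f : Fin n → Fin n
    f i = fromℕ< (bounded (Fin.toℕ<n i))
    f-inj : Injective _≡_ _≡_ f
    f-inj {i} {j} eq = Fin.toℕ-injective (injective (Fin.toℕ<n i) (Fin.toℕ<n j)
      (Fin.fromℕ<-injective _ _ (bounded (Fin.toℕ<n i)) (bounded (Fin.toℕ<n j)) eq))
    preimage = fin-injective⇒surjective f-inj (fromℕ< y<n)
    x = proj₁ preimage
    fx≡y = proj₂ preimage

open IsPerm

-- Uniqueness of increasing enumerations

StrictMono⇒injective : ∀ {f} → StrictMono f → ∀ {k l} → f k ≡ f l → k ≡ l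
StrictMono⇒injective mono {k} {l} eq with <-cmp k l
... | tri< k<l _ _ = contradiction eq (<⇒≢ (mono k<l))
... | tri≈ _ k≡l _ = k≡l
... | tri> _ _ l<k = contradiction (sym eq) (<⇒≢ (mono l<k))

StrictMono⇒mono : ∀ {f} → StrictMono f → ∀ {k l} → k ≤ l → f k ≤ f l
StrictMono⇒mono {f} mono {k} {l} k≤l with k ≟ l
... | yes refl = ≤-refl
... | no k≢l   = <⇒≤ (mono (≤∧≢⇒< k≤l k≢l))

-- The hypothesis says that `f` and `g` take the same values below `n`. By strong induction let them
-- agree below `x`, and write `x` as `p i`. If `q i` were less than `x`, then `f` would take the
-- same value at `q i` and at `x`; so `x` is at most `q i`, and `g x ≤ g (q i) ≡ f x`. The other
-- inequality is symmetric.
increasing-unique : ∀ {n f g p q} → StrictMono f → StrictMono g → IsPerm n p → IsPerm n q →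
  (∀ {i} → i < n → f (p i) ≡ g (q i)) → ∀ {x} → x < n → f x ≡ g x
increasing-unique {n} {f} {g} {p} {q} f↑ g↑ P Q eq {x} = <-rec Agree step x
  where
  Agree : ℕ → Set
  Agree x = x < n → f x ≡ g x
  above : ∀ {f g p q} → StrictMono f → StrictMono g → IsPerm n p →
    (∀ {i} → i < n → f (p i) ≡ g (q i)) →
    ∀ {x} → (∀ {y} → y < x → f y ≡ g y) → x < n → g x ≤ f x
  above {f} {g} {p} {q} f↑ g↑ P eq {x} below x<n with surjective P x<n
  ... | i , i<n , refl with q i <? p i
  ... | yes lt = contradiction
    (StrictMono⇒injective f↑ (trans (below lt) (sym (eq i<n)))) (<⇒≢ lt)
  ... | no ≮ = subst (g (p i) ≤_) (sym (eq i<n)) (StrictMono⇒mono g↑ (≮⇒≥ ≮))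
  step : ∀ x → (∀ {y} → y < x → Agree y) → Agree x
  step x rec x<n = ≤-antisym
    (above {p = q} {q = p} g↑ f↑ Q (λ i<n → sym (eq i<n)) (λ y<x → sym (rec y<x (<-trans y<x x<n))) x<n)
    (above {p = p} {q = q} f↑ g↑ P eq (λ y<x → rec y<x (<-trans y<x x<n)) x<n)

-- Transpositions and coded permutations

swap : ℕ → ℕ → ℕ → ℕ
swap a b z with z ≟ a
... | yes _ = b
... | no  _ with z ≟ b
...   | yes _ = a
...   | no  _ = z

swap-first : ∀ a b → swap a b a ≡ b
swap-first a b with a ≟ a
... | yes _  = refl
... | no a≢a = contradiction refl a≢a

swap-fixes : ∀ {a b z} → z ≢ a → z ≢ b → swap a b z ≡ z
swap-fixes {a} {b} {z} z≢a z≢b with z ≟ a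
... | yes z≡a = contradiction z≡a z≢a
... | no _ with z ≟ b
...   | yes z≡b = contradiction z≡b z≢b
...   | no _ = refl

swap-second : ∀ a b → swap a b b ≡ a
swap-second a b with b ≟ a
... | yes b≡a = b≡a
... | no _ with b ≟ b
...   | yes _  = refl
...   | no b≢b = contradiction refl b≢b

swap-cases : ∀ (P : ℕ → Set) {a b z} → P a → P b → P z → P (swap a b z)
swap-cases P {a} {b} {z} pa pb pz with z ≟ a
... | yes _ = pb
... | no  _ with z ≟ b
...   | yes _ = pa
...   | no  _ = pz

swap-involutive : ∀ a b z → swap a b (swap a b z) ≡ z
swap-involutive a b z with z ≟ a
... | yes refl = swap-second z b
... | no z≢a with z ≟ b
...   | yes refl = swap-first a z
...   | no z≢b = swap-fixes z≢a z≢b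

swap-injective : ∀ a b {y z} → swap a b y ≡ swap a b z → y ≡ z
swap-injective a b {y} {z} eq =
  trans (sym (swap-involutive a b y)) (trans (cong (swap a b) eq) (swap-involutive a b z))

swap-parity : ∀ {a b} z → parity a ≡ parity b → parity (swap a b z) ≡ parity z
swap-parity {a} {b} z eq with z ≟ a
... | yes refl = sym eq
... | no  _ with z ≟ b
...   | yes refl = eq
...   | no  _    = refl

-- A parity preserving permutation of {0,…,h-1} is coded by successive
-- transpositions of k = 0,…,h-1 with some k - 2c, where c ≤ ⌊k/2⌋.
Code : ℕ → Set
Code zero    = ⊤
Code (suc h) = Fin (suc ⌊ h /2⌋) × Code h

partner : ∀ h → Fin (suc ⌊ h /2⌋) → ℕ
partner h c = h ∸ (toℕ c + toℕ c)

decode : ∀ {h} → Code h → ℕ → ℕ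
decode {zero}  _       z = z
decode {suc h} (c , r) z = swap h (partner h c) (decode r z)

-- As `toℕ c` is at most half of `h`, the truncated subtraction in `partner` is exact.
partner+ : ∀ h c → partner h c + (toℕ c + toℕ c) ≡ h
partner+ h c = m∸n+n≡m (≤-trans (+-mono-≤ c≤ (≤-trans c≤ (⌊n/2⌋≤⌈n/2⌉ h))) (≤-reflexive (⌊n/2⌋+⌈n/2⌉≡n h)))
  where
  c≤ : toℕ c ≤ ⌊ h /2⌋
  c≤ = s≤s⁻¹ (Fin.toℕ<n c)

partner-injective : ∀ h {c c′} → partner h c ≡ partner h c′ → c ≡ c′
partner-injective h {c} {c′} eq = Fin.toℕ-injective
  (trans (n≡⌊n+n/2⌋ (toℕ c)) (trans (cong ⌊_/2⌋ doubled) (sym (n≡⌊n+n/2⌋ (toℕ c′)))))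
  where
  doubled : toℕ c + toℕ c ≡ toℕ c′ + toℕ c′
  doubled = +-cancelˡ-≡ (partner h c) _ _
    (trans (partner+ h c) (trans (sym (partner+ h c′)) (cong (_+ (toℕ c′ + toℕ c′)) (sym eq))))

parity-double : ∀ n → parity (n + n) ≡ 0ℙ
parity-double n = trans (ℙ.+-homo-+ n n) (ℙ.p+p≡0ℙ (parity n))

partner-parity : ∀ h c → parity h ≡ parity (partner h c)
partner-parity h c = begin
  parity h                                              ≡⟨ cong parity (partner+ h c) ⟨
  parity (partner h c + (toℕ c + toℕ c))                ≡⟨ ℙ.+-homo-+ (partner h c) _ ⟩
  parity (partner h c) ℙ.+ parity (toℕ c + toℕ c)       ≡⟨ cong (parity (partner h c) ℙ.+_) (parity-double (toℕ c)) ⟩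
  parity (partner h c) ℙ.+ 0ℙ                           ≡⟨ ℙ.+-identityʳ _ ⟩
  parity (partner h c)                                  ∎
  where open ≡-Reasoning

decode-parity : ∀ {h} (c : Code h) z → parity (decode c z) ≡ parity z
decode-parity {zero}  _       z = refl
decode-parity {suc h} (c , r) z = trans (swap-parity (decode r z) (partner-parity h c)) (decode-parity r z)

decode-injective : ∀ {h} (c : Code h) {y z} → decode c y ≡ decode c z → y ≡ z
decode-injective {zero}  _       eq = eq
decode-injective {suc h} (c , r) eq = decode-injective r (swap-injective h (partner h c) eq)

decode-bounded : ∀ {h} (c : Code h) {n z} → h ≤ n → z < n → decode c z < n
decode-bounded {zero}  _       _   z<n = z<n
decode-bounded {suc h} (c , r) {n} h<n z<n = swap-cases (_< n) h<n
  (≤-<-trans (m∸n≤m h (toℕ c + toℕ c)) h<n) (decode-bounded r (<⇒≤ h<n) z<n)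

decode-fixes : ∀ {h} (c : Code h) {z} → h ≤ z → decode c z ≡ z
decode-fixes {zero}  _       _   = refl
decode-fixes {suc h} (c , r) {z} h<z = trans (cong (swap h (partner h c)) (decode-fixes r (<⇒≤ h<z)))
  (swap-fixes (>⇒≢ h<z) (>⇒≢ (≤-<-trans (m∸n≤m h (toℕ c + toℕ c)) h<z)))

decode-last : ∀ {h} c (r : Code h) → decode {suc h} (c , r) h ≡ partner h c
decode-last {h} c r = trans (cong (swap h (partner h c)) (decode-fixes r ≤-refl)) (swap-first h (partner h c))

-- The earlier transpositions fix `h`, so the image of `h` is its partner and determines `c`;
-- undoing the last transposition leaves the codes `r` and `r′`.
decode-unique : ∀ {h} (c c′ : Code h) → (∀ {z} → z < h → decode c z ≡ decode c′ z) → c ≡ c′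
decode-unique {zero}  _       _         _  = refl
decode-unique {suc h} (c , r) (c′ , r′) eq
  with partner-injective h {c} {c′} (trans (sym (decode-last c r)) (trans (eq ≤-refl) (decode-last c′ r′)))
... | refl = cong (c ,_) (decode-unique r r′
  (λ z<h → swap-injective h (partner h c) (eq (m<n⇒m<1+n z<h))))

-- Signs and offsets from the centre

signs : ∀ {n} → Vec Bool n → ℕ → Bool
signs []       _       = true
signs (b ∷ _)  zero    = b
signs (_ ∷ bs) (suc k) = signs bs k

signs-unique : ∀ {n} (bs bs′ : Vec Bool n) → (∀ {k} → k < n → signs bs k ≡ signs bs′ k) → bs ≡ bs′
signs-unique []       []         _  = refl
signs-unique (b ∷ bs) (b′ ∷ bs′) eq = cong₂ _∷_ (eq z<s) (signs-unique bs bs′ (λ k<n → eq (s<s k<n)))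

-- `side b k` lies at distance `k + 1` from the centre, on the right if `b` is `true`. In this form
-- the reflection about the centre is a change of sign.
data Offset : Set where
  centre : Offset
  side   : Bool → ℕ → Offset

negate : Offset → Offset
negate centre     = centre
negate (side b k) = side (not b) k

side-injectiveˡ : ∀ {b b′ k k′} → side b k ≡ side b′ k′ → b ≡ b′
side-injectiveˡ refl = refl

side-injectiveʳ : ∀ {b b′ k k′} → side b k ≡ side b′ k′ → k ≡ k′
side-injectiveʳ refl = refl

InRange : ℕ → Offset → Set
InRange h centre     = ⊤
InRange h (side _ k) = k < h

negate-inRange : ∀ {h} z → InRange h z → InRange h (negate z)
negate-inRange centre     _   = tt
negate-inRange (side _ _) k<h = k<h

distance : Offset → ℕ
distance centre     = 0
distance (side _ k) = suc k

position : ℕ → Offset → ℕ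
position h centre         = h
position h (side true k)  = suc (h + k)
position h (side false k) = h ∸ suc k

offset : ℕ → ℕ → Offset
offset zero    zero    = centre
offset zero    (suc i) = side true i
offset (suc h) zero    = side false h
offset (suc h) (suc i) = offset h i

offset-centre : ∀ h → offset h h ≡ centre
offset-centre zero    = refl
offset-centre (suc h) = offset-centre h

offset-right : ∀ h k → offset h (suc (h + k)) ≡ side true k
offset-right zero    k = refl
offset-right (suc h) k = offset-right h k

offset-left : ∀ i k → offset (suc (i + k)) i ≡ side false k
offset-left zero    k = refl
offset-left (suc i) k = offset-left i k

position-offset : ∀ h i → position h (offset h i) ≡ i
position-offset h i with compare h i
... | less .h k    rewrite offset-right h k = refl
... | equal .h     rewrite offset-centre h = refl
... | greater .i k rewrite offset-left i k = m+n∸n≡m i k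

offset-inRange : ∀ h i → i ≤ h + h → InRange h (offset h i)
offset-inRange h i i≤2h with compare h i
... | less .h k    rewrite offset-right h k = +-cancelˡ-≤ h _ _ (subst (_≤ h + h) (sym (+-suc h k)) i≤2h)
... | equal .h     rewrite offset-centre h = tt
... | greater .i k rewrite offset-left i k = s≤s (m≤n+m k i)

offset-position : ∀ h z → InRange h z → offset h (position h z) ≡ z
offset-position h centre         _   = offset-centre h
offset-position h (side true k)  _   = offset-right h k
offset-position h (side false k) k<h =
  trans (cong (λ t → offset t i) (trans (sym (m∸n+n≡m k<h)) (+-suc i k))) (offset-left i k)
  where i = h ∸ suc k

position-injective : ∀ h {z z′} → InRange h z → InRange h z′ → position h z ≡ position h z′ → z ≡ z′
position-injective h {z} {z′} r r′ eq =
  trans (sym (offset-position h z r)) (trans (cong (offset h) eq) (offset-position h z′ r′))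

position-negate : ∀ h z → InRange h z → position h z + position h (negate z) ≡ h + h
position-negate h centre        _   = refl
position-negate h (side true k) k<h = trans (cong (_+ (h ∸ suc k)) (sym (+-suc h k)))
  (trans (+-assoc h (suc k) (h ∸ suc k)) (cong (h +_) (m+[n∸m]≡n k<h)))
position-negate h (side false k) k<h =
  trans (+-comm (h ∸ suc k) (suc (h + k))) (position-negate h (side true k) k<h)

position≤ : ∀ h z → InRange h z → position h z ≤ h + h
position≤ h z r = subst (position h z ≤_) (position-negate h z r) (m≤m+n _ _)

-- The position is `h` plus or minus the distance, and the sign does not matter modulo 2.
position-parity : ∀ h z → InRange h z → parity (position h z) ≡ parity h ℙ.+ parity (distance z)
position-parity h centre         _   = sym (ℙ.+-identityʳ (parity h))
position-parity h (side true k)  _   = trans (cong parity (sym (+-suc h k))) (ℙ.+-homo-+ h (suc k))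
position-parity h (side false k) k<h = begin
  parity i                                        ≡⟨ ℙ.+-identityʳ _ ⟨
  parity i ℙ.+ 0ℙ                                 ≡⟨ cong (parity i ℙ.+_) (ℙ.p+p≡0ℙ (parity (suc k))) ⟨
  parity i ℙ.+ (parity (suc k) ℙ.+ parity (suc k)) ≡⟨ ℙ.+-assoc (parity i) _ _ ⟨
  parity i ℙ.+ parity (suc k) ℙ.+ parity (suc k)  ≡⟨ cong (ℙ._+ parity (suc k)) (ℙ.+-homo-+ i (suc k)) ⟨
  parity (i + suc k) ℙ.+ parity (suc k)           ≡⟨ cong (λ t → parity t ℙ.+ parity (suc k)) (m∸n+n≡m k<h) ⟩
  parity h ℙ.+ parity (suc k)                     ∎
  where
  open ≡-Reasoning
  i = h ∸ suc k

position-surjective : ∀ h {i} → i ≤ h + h → ∃ λ z → InRange h z × position h z ≡ i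
position-surjective h {i} i≤2h = offset h i , offset-inRange h i i≤2h , position-offset h i

-- Arrangements of the positions

turn : Bool → Bool → Bool
turn true  b = b
turn false b = not b

turn-injective : ∀ e {b b′} → turn e b ≡ turn e b′ → b ≡ b′
turn-injective true  eq = eq
turn-injective false {true}  {true}  _ = refl
turn-injective false {false} {false} _ = refl

turn-not : ∀ e b → turn e (not b) ≡ not (turn e b)
turn-not true  _ = refl
turn-not false _ = refl

turn-true : ∀ e → turn e true ≡ e
turn-true true  = refl
turn-true false = refl

-- Arrangement h acts on the offsets at distance at most h + 1.  The first sign is
-- fixed to be positive: this picks one arrangement out of each pair of mirror
-- images.
Arrangement : ℕ → Set
Arrangement h = Vec Bool h × Code (suc h)

act : ∀ {h} → Arrangement h → Offset → Offset
act _        centre     = centre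
act (bs , c) (side b k) = side (turn (signs (true ∷ bs) k) b) (decode c k)

act-inRange : ∀ {h} (a : Arrangement h) z → InRange (suc h) z → InRange (suc h) (act a z)
act-inRange _       centre     _   = tt
act-inRange (_ , c) (side _ _) k<h = decode-bounded c ≤-refl k<h

act-injective : ∀ {h} (a : Arrangement h) z z′ → act a z ≡ act a z′ → z ≡ z′
act-injective _        centre     centre      _  = refl
act-injective (bs , c) (side b k) (side b′ k′) eq with decode-injective c (side-injectiveʳ eq)
... | refl = cong (λ t → side t k) (turn-injective (signs (true ∷ bs) k) (side-injectiveˡ eq))

act-negate : ∀ {h} (a : Arrangement h) z → act a (negate z) ≡ negate (act a z)
act-negate _        centre     = refl
act-negate (bs , c) (side b k) = cong (λ t → side t (decode c k)) (turn-not (signs (true ∷ bs) k) b)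

parity-suc : ∀ n → parity (suc n) ≡ parity n ℙ.⁻¹
parity-suc = ℙ.+-homo-+ 1

act-parity : ∀ {h} (a : Arrangement h) z → parity (distance (act a z)) ≡ parity (distance z)
act-parity _       centre     = refl
act-parity (_ , c) (side _ k) = trans (parity-suc (decode c k))
  (trans (cong ℙ._⁻¹ (decode-parity c k)) (sym (parity-suc k)))

arrange : ∀ {h} → Arrangement h → ℕ → ℕ
arrange {h} a i = position (suc h) (act a (offset (suc h) i))

width : ℕ → ℕ
width h = suc (suc h + suc h)

module _ {h : ℕ} where

  private H = suc h

  arrange-position : ∀ (a : Arrangement h) z → InRange H z → arrange a (position H z) ≡ position H (act a z)
  arrange-position a z r = cong (λ t → position H (act a t)) (offset-position H z r)

  arrange-isPerm : ∀ (a : Arrangement h) → IsPerm (width h) (arrange a)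
  arrange-isPerm a = record
    { bounded = λ {i} i< → s≤s (position≤ H _ (act-inRange a _ (offset-inRange H i (s≤s⁻¹ i<))))
    ; injective = λ {i} {j} i< j< eq → trans (sym (position-offset H i)) (trans
        (cong (position H) (act-injective a _ _ (position-injective H
          (act-inRange a _ (offset-inRange H i (s≤s⁻¹ i<)))
          (act-inRange a _ (offset-inRange H j (s≤s⁻¹ j<))) eq)))
        (position-offset H j))
    }

  -- In terms of offsets the mirror image is `negate`, which commutes with `act`.
  arrange-mirror : ∀ (a : Arrangement h) i i′ → i + i′ ≡ H + H → arrange a i + arrange a i′ ≡ H + H
  arrange-mirror a i i′ eq with position-surjective H (subst (i ≤_) eq (m≤m+n i i′))
  ... | z , r , refl with +-cancelˡ-≡ (position H z) _ _ (trans eq (sym (position-negate H z r)))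
  ... | refl = begin
    arrange a (position H z) + arrange a (position H (negate z))
      ≡⟨ cong₂ _+_ (arrange-position a z r) (arrange-position a (negate z) (negate-inRange z r)) ⟩
    position H (act a z) + position H (act a (negate z))
      ≡⟨ cong (λ t → position H (act a z) + position H t) (act-negate a z) ⟩
    position H (act a z) + position H (negate (act a z))
      ≡⟨ position-negate H (act a z) (act-inRange a z r) ⟩
    H + H ∎
    where open ≡-Reasoning

  arrange-parity : ∀ (a : Arrangement h) {i} → i < width h → parity (arrange a i) ≡ parity i
  arrange-parity a i< with position-surjective H (s≤s⁻¹ i<)
  ... | z , r , refl = begin
    parity (arrange a (position H z))            ≡⟨ cong parity (arrange-position a z r) ⟩
    parity (position H (act a z))                ≡⟨ position-parity H (act a z) (act-inRange a z r) ⟩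
    parity H ℙ.+ parity (distance (act a z))     ≡⟨ cong (parity H ℙ.+_) (act-parity a z) ⟩
    parity H ℙ.+ parity (distance z)             ≡⟨ position-parity H z r ⟨
    parity (position H z)                        ∎
    where open ≡-Reasoning

  -- This is where the fixed first sign enters: the right neighbour of the centre stays in the right
  -- half.
  arrange-right : ∀ (a : Arrangement h) → H < arrange a (suc H)
  arrange-right a = subst (λ t → H < arrange a (suc t)) (+-identityʳ H)
    (subst (H <_) (sym (arrange-position a (side true 0) z<s)) (s≤s (m≤m+n H _)))

  arrange-unique : ∀ (a a′ : Arrangement h) → (∀ {i} → i < width h → arrange a i ≡ arrange a′ i) → a ≡ a′
  arrange-unique a@(bs , c) a′@(bs′ , c′) eq = cong₂ _,_
    (signs-unique bs bs′ (λ {k} k<h → trans (sym (turn-true _))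
      (trans (side-injectiveˡ (act-eq (s<s k<h))) (turn-true _))))
    (decode-unique c c′ (λ k<H → side-injectiveʳ (act-eq k<H)))
    where
    act-eq : ∀ {k} → k < H → act a (side true k) ≡ act a′ (side true k)
    act-eq {k} k<H = position-injective H
      (act-inRange a (side true k) k<H) (act-inRange a′ (side true k) k<H)
      (trans (sym (arrange-position a (side true k) k<H))
        (trans (eq (s≤s (position≤ H (side true k) k<H))) (arrange-position a′ (side true k) k<H)))

  -- Otherwise `arrange a′` would send both `suc H` and its mirror image into the right half, by
  -- `arrange-right` for `a′` and `a`. By `arrange-mirror` these two images sum to `H + H`.
  arrange-not-mirrored : ∀ (a a′ : Arrangement h) →
    ¬ (∀ {i} → i < width h → arrange a i ≡ arrange a′ (H + H ∸ i))
  arrange-not-mirrored a a′ eq = <-irrefl (sym (arrange-mirror a′ (suc H) (H + H ∸ suc H) (m+[n∸m]≡n H<2H)))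
    (+-mono-< (arrange-right a′) (subst (H <_) (eq (s≤s H<2H)) (arrange-right a)))
    where
    H<2H : suc H ≤ H + H
    H<2H = s≤s (subst (_≤ h + H) (+-comm h 1 ) (+-monoʳ-≤ h (s≤s z≤n)))

-- Labels

-- With b = 0ℙ the cells of even value get the small labels, with b = 1ℙ the
-- cells of odd value do; label n b is 0-based.
label : ℕ → Parity → ℕ → ℕ
label n b v with parity v ℙ.≟ b
... | yes _ = ⌊ v /2⌋
... | no  _ = n ∸ suc ⌊ v /2⌋

≢⇒⁻¹ : ∀ {p q} → p ≢ q → p ≡ q ℙ.⁻¹
≢⇒⁻¹ {0ℙ} {0ℙ} p≢q = contradiction refl p≢q
≢⇒⁻¹ {0ℙ} {1ℙ} _   = refl
≢⇒⁻¹ {1ℙ} {0ℙ} _   = refl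
≢⇒⁻¹ {1ℙ} {1ℙ} p≢q = contradiction refl p≢q

label-same : ∀ n {b v} → parity v ≡ b → label n b v ≡ ⌊ v /2⌋
label-same n {b} {v} eq with parity v ℙ.≟ b
... | yes _  = refl
... | no ≢ = contradiction eq ≢

label-other : ∀ {n b v} → v < n → parity v ≡ b ℙ.⁻¹ → label n b v + suc ⌊ v /2⌋ ≡ n
label-other {n} {b} {v} v<n eq with parity v ℙ.≟ b
... | yes ≡b = contradiction (trans (sym ≡b) eq) (ℙ.p≢p⁻¹ b)
... | no _   = m∸n+n≡m (≤-<-trans (⌊n/2⌋≤n v) v<n)

bit : Parity → ℕ
bit 0ℙ = 0
bit 1ℙ = 1

halves : ∀ v {q} → parity v ≡ q → v ≡ bit q + (⌊ v /2⌋ + ⌊ v /2⌋)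
halves zero          refl = refl
halves (suc zero)    refl = refl
halves (suc (suc v)) refl = trans (cong (2 +_) (halves v refl)) (shift (bit (parity v)) ⌊ v /2⌋)
  where
  shift : ∀ b w → 2 + (b + (w + w)) ≡ b + (suc w + suc w)
  shift = solve-∀

bits-opposite : ∀ b → bit b + bit (b ℙ.⁻¹) ≡ 1
bits-opposite 0ℙ = refl
bits-opposite 1ℙ = refl

-- Equal labels would give `x + suc y ≡ n`. As exactly one of `v` and `w` is odd, their sum would be
-- `2n - 1`, whereas two numbers below `n` sum to at most `2n - 2`.
label-distinct : ∀ {n b v w} → v < n → w < n → parity v ≡ b → parity w ≡ b ℙ.⁻¹ →
  label n b v ≢ label n b w
label-distinct {n} {b} {v} {w} v<n w<n pv pw eq = <⇒≢ too-big v+w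
  where
  x = ⌊ v /2⌋
  y = ⌊ w /2⌋
  x+y : x + suc y ≡ n
  x+y = trans (cong (_+ suc y) (trans (sym (label-same n pv)) eq)) (label-other w<n pw)
  collect : ∀ c d x y → 1 + (c + (x + x) + (d + (y + y))) ≡ c + d + (x + suc y + (x + y))
  collect = solve-∀
  collect′ : ∀ x y → 1 + (x + suc y + (x + y)) ≡ x + suc y + (x + suc y)
  collect′ = solve-∀
  v+w : suc (v + w) ≡ n + n
  v+w = begin
    suc (v + w)                                            ≡⟨ cong suc (cong₂ _+_ (halves v pv) (halves w pw)) ⟩
    suc (bit b + (x + x) + (bit (b ℙ.⁻¹) + (y + y)))       ≡⟨ collect (bit b) _ x y ⟩
    bit b + bit (b ℙ.⁻¹) + (x + suc y + (x + y))           ≡⟨ cong (_+ (x + suc y + (x + y))) (bits-opposite b) ⟩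
    suc (x + suc y + (x + y))                              ≡⟨ collect′ x y ⟩
    x + suc y + (x + suc y)                                ≡⟨ cong₂ _+_ x+y x+y ⟩
    n + n                                                  ∎
    where open ≡-Reasoning
  too-big : suc (v + w) < n + n
  too-big = subst (_≤ n + n) (cong suc (+-suc v w)) (+-mono-≤ v<n w<n)

parity-cases : ∀ v b → parity v ≡ b ⊎ parity v ≡ b ℙ.⁻¹
parity-cases v b with parity v ℙ.≟ b
... | yes ≡b = inj₁ ≡b
... | no  ≢b = inj₂ (≢⇒⁻¹ ≢b)

halves-injective : ∀ {q} v w → parity v ≡ q → parity w ≡ q → ⌊ v /2⌋ ≡ ⌊ w /2⌋ → v ≡ w
halves-injective {q} v w pv pw eq =
  trans (halves v pv) (trans (cong (λ t → bit q + (t + t)) eq) (sym (halves w pw)))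

label-injective : ∀ {n b v w} → v < n → w < n → label n b v ≡ label n b w → v ≡ w
label-injective {n} {b} {v} {w} v<n w<n eq with parity-cases v b | parity-cases w b
... | inj₁ pv | inj₁ pw =
  halves-injective v w pv pw (trans (sym (label-same n pv)) (trans eq (label-same n pw)))
... | inj₁ pv | inj₂ pw = contradiction eq (label-distinct v<n w<n pv pw)
... | inj₂ pv | inj₁ pw = contradiction (sym eq) (label-distinct w<n v<n pw pv)
... | inj₂ pv | inj₂ pw = halves-injective v w pv pw
  (suc-injective (+-cancelˡ-≡ (label n b v) _ _
    (trans (label-other v<n pv) (trans (sym (label-other w<n pw)) (cong (_+ suc ⌊ w /2⌋) (sym eq))))))

label-bounded : ∀ {n b v} → v < n → label n b v < n
label-bounded {n} {b} {v} v<n with parity v ℙ.≟ b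
... | yes _ = ≤-<-trans (⌊n/2⌋≤n v) v<n
... | no  _ = ∸-monoʳ-< {n} {suc ⌊ v /2⌋} {0} z<s (≤-<-trans (⌊n/2⌋≤n v) v<n)

-- Sums around a face

magicValue : ℕ → Parity → ℕ
magicValue n 0ℙ = 2 * n + 3
magicValue n 1ℙ = 2 * n + 1

private
  -- Vertices one and three contribute `suc w₁` and `suc w₃`, the other two `n - w₂` and `n - w₄`.
  -- Halving the equality of diagonals shows that `w₁ + w₃` exceeds `w₂ + w₄` by 1 if `b` is `0ℙ`
  -- and falls short of it by 1 if `b` is `1ℙ`.
  face-same : ∀ {n} b {v₁ v₂ v₃ v₄} → v₂ < n → v₄ < n →
    parity v₁ ≡ b → parity v₂ ≡ b ℙ.⁻¹ → parity v₃ ≡ b → parity v₄ ≡ b ℙ.⁻¹ →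
    v₁ + v₃ ≡ v₂ + v₄ →
    suc (label n b v₁) + suc (label n b v₂) + suc (label n b v₃) + suc (label n b v₄) ≡ magicValue n b
  face-same {n} b {v₁} {v₂} {v₃} {v₄} v₂<n v₄<n p₁ p₂ p₃ p₄ eq = begin
    suc (label n b v₁) + suc l₂ + suc (label n b v₃) + suc l₄
      ≡⟨ cong₂ (λ s t → suc s + suc l₂ + suc t + suc l₄) (label-same n p₁) (label-same n p₃) ⟩
    suc w₁ + suc l₂ + suc w₃ + suc l₄
      ≡⟨ finish b halved ⟩
    magicValue n b ∎
    where
    open ≡-Reasoning
    w₁ = ⌊ v₁ /2⌋
    w₂ = ⌊ v₂ /2⌋
    w₃ = ⌊ v₃ /2⌋
    w₄ = ⌊ v₄ /2⌋
    l₂ = label n b v₂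
    l₄ = label n b v₄
    l₂+ : l₂ + suc w₂ ≡ n
    l₂+ = label-other v₂<n p₂
    l₄+ : l₄ + suc w₄ ≡ n
    l₄+ = label-other v₄<n p₄
    twice : ∀ c x y → c + (x + x) + (c + (y + y)) ≡ 2 * (c + (x + y))
    twice = solve-∀
    halved : bit b + (w₁ + w₃) ≡ bit (b ℙ.⁻¹) + (w₂ + w₄)
    halved = *-cancelˡ-≡ _ _ 2 (trans (sym (twice (bit b) w₁ w₃))
      (trans (cong₂ _+_ (sym (halves v₁ p₁)) (sym (halves v₃ p₃)))
        (trans eq (trans (cong₂ _+_ (halves v₂ p₂) (halves v₄ p₄)) (twice (bit (b ℙ.⁻¹)) w₂ w₄)))))
    gather : ∀ x l y k → suc x + suc l + suc y + suc k ≡ x + y + (4 + (l + k))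
    gather = solve-∀
    spread₀ : ∀ x y l k → 1 + (x + y) + (4 + (l + k)) ≡ (l + suc x) + (k + suc y) + 3
    spread₀ = solve-∀
    spread₁ : ∀ a l k → a + (4 + (l + k)) ≡ 1 + a + (3 + (l + k))
    spread₁ = solve-∀
    spread₂ : ∀ x y l k → (x + y) + (3 + (l + k)) ≡ (l + suc x) + (k + suc y) + 1
    spread₂ = solve-∀
    two : ∀ n c → n + n + c ≡ 2 * n + c
    two = solve-∀
    finish : ∀ b → bit b + (w₁ + w₃) ≡ bit (b ℙ.⁻¹) + (w₂ + w₄) →
      suc w₁ + suc l₂ + suc w₃ + suc l₄ ≡ magicValue n b
    finish 0ℙ e = begin
      suc w₁ + suc l₂ + suc w₃ + suc l₄        ≡⟨ gather w₁ l₂ w₃ l₄ ⟩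
      w₁ + w₃ + (4 + (l₂ + l₄))                ≡⟨ cong (_+ (4 + (l₂ + l₄))) e ⟩
      1 + (w₂ + w₄) + (4 + (l₂ + l₄))          ≡⟨ spread₀ w₂ w₄ l₂ l₄ ⟩
      (l₂ + suc w₂) + (l₄ + suc w₄) + 3        ≡⟨ cong₂ (λ s t → s + t + 3) l₂+ l₄+ ⟩
      n + n + 3                                ≡⟨ two n 3 ⟩
      2 * n + 3                                ∎
    finish 1ℙ e = begin
      suc w₁ + suc l₂ + suc w₃ + suc l₄        ≡⟨ gather w₁ l₂ w₃ l₄ ⟩
      w₁ + w₃ + (4 + (l₂ + l₄))                ≡⟨ spread₁ (w₁ + w₃) l₂ l₄ ⟩
      1 + (w₁ + w₃) + (3 + (l₂ + l₄))          ≡⟨ cong (_+ (3 + (l₂ + l₄))) e ⟩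
      (w₂ + w₄) + (3 + (l₂ + l₄))              ≡⟨ spread₂ w₂ w₄ l₂ l₄ ⟩
      (l₂ + suc w₂) + (l₄ + suc w₄) + 1        ≡⟨ cong₂ (λ s t → s + t + 1) l₂+ l₄+ ⟩
      n + n + 1                                ≡⟨ two n 1 ⟩
      2 * n + 1                                ∎

face-sum : ∀ {n} b q {v₁ v₂ v₃ v₄} → v₁ < n → v₂ < n → v₃ < n → v₄ < n →
  parity v₁ ≡ q → parity v₂ ≡ q ℙ.⁻¹ → parity v₃ ≡ q → parity v₄ ≡ q ℙ.⁻¹ →
  v₁ + v₃ ≡ v₂ + v₄ →
  suc (label n b v₁) + suc (label n b v₂) + suc (label n b v₃) + suc (label n b v₄) ≡ magicValue n b
face-sum {n} b q {v₁} {v₂} {v₃} {v₄} v₁< v₂< v₃< v₄< p₁ p₂ p₃ p₄ eq with q ℙ.≟ b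
... | yes refl = face-same b {v₁} {v₂} {v₃} {v₄} v₂< v₄< p₁ p₂ p₃ p₄ eq
-- Starting the face one vertex later exchanges its diagonals and thus their parities.
... | no q≢b = trans (rotate (suc (label n b v₁)) (suc (label n b v₂)) (suc (label n b v₃)) (suc (label n b v₄)))
  (face-same b {v₂} {v₃} {v₄} {v₁} v₃< v₁< (trans p₂ q⁻¹≡b) (trans p₃ q≡b⁻¹) (trans p₄ q⁻¹≡b) (trans p₁ q≡b⁻¹)
    (trans (sym eq) (+-comm v₁ v₃)))
  where
  q≡b⁻¹ = ≢⇒⁻¹ q≢b
  q⁻¹≡b : q ℙ.⁻¹ ≡ b
  q⁻¹≡b = trans (cong ℙ._⁻¹ q≡b⁻¹) (ℙ.⁻¹-involutive b)
  rotate : ∀ a b c d → a + b + c + d ≡ b + c + d + a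
  rotate = solve-∀

-- From sums of two functions to face-magic labelings

mirror-parity : ∀ h {x} → x ≤ h + h → parity (h + h ∸ x) ≡ parity x
mirror-parity h {x} x≤ = ℙ.+-cancelʳ-≡ (parity x) _ _ (trans (sym (ℙ.+-homo-+ (h + h ∸ x) x))
  (trans (cong parity (m∸n+n≡m x≤)) (trans (parity-double h) (sym (ℙ.p+p≡0ℙ (parity x))))))

-- Collects what the labeling needs from the two enumerations, apart from radices. The mirror
-- conditions serve the faces that cross the boundary.
record Grid (h : ℕ) (α β : ℕ → ℕ) : Set where
  private
    m : ℕ
    m = suc (h + h)
  field
    value-bounded   : ∀ {i j} → i < m → j < m → α i + β j < m * m
    value-injective : ∀ {i i′ j j′} → i < m → i′ < m → j < m → j′ < m →
      α i + β j ≡ α i′ + β j′ → i ≡ i′ × j ≡ j′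
    α-mirror        : ∃ λ c → ∀ i → i ≤ h + h → α i + α (h + h ∸ i) ≡ c
    β-mirror        : ∃ λ c → ∀ i → i ≤ h + h → β i + β (h + h ∸ i) ≡ c
    α-parity        : ∀ {i} → i < m → parity (α i) ≡ parity i
    β-parity        : ∀ {i} → i < m → parity (β i) ≡ parity i

  cell : Parity → Fin m × Fin m → Fin (m * m)
  cell b (i , j) = fromℕ< (label-bounded {b = b} (value-bounded (Fin.toℕ<n i) (Fin.toℕ<n j)))

  cell-injective : ∀ b → Injective _≡_ _≡_ (cell b)
  cell-injective b {i , j} {i′ , j′} eq
    with value-injective (Fin.toℕ<n i) (Fin.toℕ<n i′) (Fin.toℕ<n j) (Fin.toℕ<n j′)
      (label-injective {b = b} (value-bounded (Fin.toℕ<n i) (Fin.toℕ<n j)) (value-bounded (Fin.toℕ<n i′) (Fin.toℕ<n j′))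
        (Fin.fromℕ<-injective _ _ _ _ eq))
  ... | i≡ , j≡ = cong₂ _,_ (Fin.toℕ-injective i≡) (Fin.toℕ-injective j≡)

  labeling : Parity → Labeling m m
  labeling b = mk⤖ (cell-injective b , surj)
    where
    open Inverse (Fin.*↔× {m} {m}) using (to; from; strictlyInverseʳ)
    to-injective : Injective _≡_ _≡_ to
    to-injective {x} {y} eq = trans (sym (strictlyInverseʳ x)) (trans (cong from eq) (strictlyInverseʳ y))
    -- The pigeonhole principle applies after identifying `Fin m × Fin m` with `Fin (m * m)`.
    surj : ∀ y → ∃ λ x → ∀ {z} → z ≡ x → cell b z ≡ y
    surj y with fin-injective⇒surjective (λ {x} {x′} eq → to-injective (cell-injective b {to x} {to x′} eq)) y
    ... | x , eq = to x , λ { refl → eq }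

  value : ℕ → ℕ → ℕ
  value i j = α i + β j

  -- The indices enter through equations, so that expressions such as `m + 1 ∸ i` in the face
  -- conditions can be brought into successor form separately.
  at-labeling : ∀ b {i j x y} → i ≡ suc x → j ≡ suc y → x < m → y < m →
    at (labeling b) i j ≡ suc (label (m * m) b (value x y))
  at-labeling b {x = x} {y} refl refl x<m y<m with x <? m | y <? m
  ... | yes p | yes q = cong suc (trans (Fin.toℕ-fromℕ< _)
    (cong₂ (λ s t → label (m * m) b (value s t)) (Fin.toℕ-fromℕ< p) (Fin.toℕ-fromℕ< q)))
  ... | yes _ | no ≮  = contradiction y<m ≮
  ... | no ≮  | _     = contradiction x<m ≮

  private
    T = h + h

    value-parity : ∀ {x y} → x < m → y < m → parity (value x y) ≡ parity (x + y)
    value-parity {x} {y} x<m y<m = trans (ℙ.+-homo-+ (α x) (β y))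
      (trans (cong₂ ℙ._+_ (α-parity x<m) (β-parity y<m)) (sym (ℙ.+-homo-+ x y)))

    mirror-shift : ∀ {x} → x ≤ T → m + 1 ∸ suc x ≡ suc (T ∸ x)
    mirror-shift {x} x≤ = trans (cong (_∸ x) (+-comm T 1)) (+-∸-assoc 1 x≤)

    mirror-step : ∀ {x} → x < T → T ∸ x ≡ suc (T ∸ suc x)
    mirror-step {x} x< = ∸-suc x<
      where
      ∸-suc : ∀ {a b} → a < b → b ∸ a ≡ suc (b ∸ suc a)
      ∸-suc {a} {suc b} (s≤s a≤b) = +-∸-assoc 1 a≤b

    T<m : T < m
    T<m = ≤-refl

    mirror< : ∀ x → T ∸ x < m
    mirror< x = s≤s (m∸n≤m T x)

    at-face : ∀ b q {i₁ i₂ i₃ i₄ j₁ j₂ j₃ j₄ x₁ x₂ x₃ x₄ y₁ y₂ y₃ y₄} →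
      i₁ ≡ suc x₁ → j₁ ≡ suc y₁ → i₂ ≡ suc x₂ → j₂ ≡ suc y₂ →
      i₃ ≡ suc x₃ → j₃ ≡ suc y₃ → i₄ ≡ suc x₄ → j₄ ≡ suc y₄ →
      x₁ < m → y₁ < m → x₂ < m → y₂ < m → x₃ < m → y₃ < m → x₄ < m → y₄ < m →
      parity (x₁ + y₁) ≡ q → parity (x₂ + y₂) ≡ q ℙ.⁻¹ → parity (x₃ + y₃) ≡ q → parity (x₄ + y₄) ≡ q ℙ.⁻¹ →
      value x₁ y₁ + value x₃ y₃ ≡ value x₂ y₂ + value x₄ y₄ →
      at (labeling b) i₁ j₁ + at (labeling b) i₂ j₂ + at (labeling b) i₃ j₃ + at (labeling b) i₄ j₄
        ≡ magicValue (m * m) b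
    at-face b q i₁ j₁ i₂ j₂ i₃ j₃ i₄ j₄ x₁ y₁ x₂ y₂ x₃ y₃ x₄ y₄ p₁ p₂ p₃ p₄ eq = trans
      (cong₂ _+_ (cong₂ _+_ (cong₂ _+_ (at-labeling b i₁ j₁ x₁ y₁) (at-labeling b i₂ j₂ x₂ y₂))
        (at-labeling b i₃ j₃ x₃ y₃)) (at-labeling b i₄ j₄ x₄ y₄))
      (face-sum b q (value-bounded x₁ y₁) (value-bounded x₂ y₂) (value-bounded x₃ y₃) (value-bounded x₄ y₄)
        (trans (value-parity x₁ y₁) p₁) (trans (value-parity x₂ y₂) p₂)
        (trans (value-parity x₃ y₃) p₃) (trans (value-parity x₄ y₄) p₄) eq)

    interchange : ∀ a b c d → (a + b) + (c + d) ≡ (a + c) + (b + d)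
    interchange = solve-∀

    parity-T+ : ∀ x → parity (x + T) ≡ parity x
    parity-T+ x = trans (ℙ.+-homo-+ x T) (trans (cong (parity x ℙ.+_) (parity-double h)) (ℙ.+-identityʳ _))

  labeling-magic : ∀ b → FaceMagic (labeling b) (magicValue (m * m) b)
  labeling-magic b = inner , vertical , horizontal
    where
    L = labeling b
    inner : ∀ i j → 1 ≤ i → i ≤ T → 1 ≤ j → j ≤ T →
      at L i j + at L (i + 1) j + at L i (j + 1) + at L (i + 1) (j + 1) ≡ magicValue (m * m) b
    inner (suc x) (suc y) _ x<T _ y<T = trans
      -- Exchanging the last two summands lists the vertices in cyclic order, with opposite vertices
      -- in places one and three.
      (last-two (at L (suc x) (suc y) + at L (suc x + 1) (suc y)) _ _)
      (at-face b (parity (x + y))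
        refl refl (+-comm (suc x) 1) refl (+-comm (suc x) 1) (+-comm (suc y) 1) refl (+-comm (suc y) 1)
        x<m y<m sx<m y<m sx<m sy<m x<m sy<m
        refl (parity-suc (x + y)) (cong parity (cong suc (+-suc x y)))
        (trans (cong parity (+-suc x y)) (parity-suc (x + y)))
        (exchange (α x) (β y) (α (suc x)) (β (suc y))))
      where
      x<m = m<n⇒m<1+n x<T
      y<m = m<n⇒m<1+n y<T
      sx<m = s≤s x<T
      sy<m = s≤s y<T
      last-two : ∀ a c d → a + c + d ≡ a + d + c
      last-two = solve-∀
      exchange : ∀ a b c d → (a + b) + (c + d) ≡ (c + b) + (a + d)
      exchange = solve-∀
    vertical : ∀ i → 1 ≤ i → i ≤ T →
      at L i m + at L (i + 1) m + at L (m + 1 ∸ i) 1 + at L (m ∸ i) 1 ≡ magicValue (m * m) b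
    vertical (suc x) _ x<T = at-face b (parity x)
      refl refl (+-comm (suc x) 1) refl (mirror-shift (<⇒≤ x<T)) refl (mirror-step x<T) refl
      (m<n⇒m<1+n x<T) T<m (s≤s x<T) T<m (mirror< x) z<s (mirror< (suc x)) z<s
      (parity-T+ x) (trans (parity-T+ (suc x)) (parity-suc x))
      (trans (cong parity (+-identityʳ (T ∸ x))) (mirror-parity h (<⇒≤ x<T)))
      (trans (cong parity (+-identityʳ (T ∸ suc x))) (trans (mirror-parity h x<T) (parity-suc x)))
      -- Opposite vertices lie in mirrored rows, one in the last column and one in the first, so by
      -- `α-mirror` both diagonals have the same sum.
      (trans (interchange (α x) _ _ _) (trans
        (cong (_+ (β T + β 0)) (trans (proj₂ α-mirror x (<⇒≤ x<T)) (sym (proj₂ α-mirror (suc x) x<T))))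
        (interchange (α (suc x)) _ _ _)))
    horizontal : ∀ j → 1 ≤ j → j ≤ T →
      at L m j + at L m (j + 1) + at L 1 (m + 1 ∸ j) + at L 1 (m ∸ j) ≡ magicValue (m * m) b
    horizontal (suc y) _ y<T = at-face b (parity y)
      refl refl refl (+-comm (suc y) 1) refl (mirror-shift (<⇒≤ y<T)) refl (mirror-step y<T)
      T<m (m<n⇒m<1+n y<T) T<m (s≤s y<T) z<s (mirror< y) z<s (mirror< (suc y))
      (trans (cong parity (+-comm T y)) (parity-T+ y))
      (trans (cong parity (+-comm T (suc y))) (trans (parity-T+ (suc y)) (parity-suc y)))
      (mirror-parity h (<⇒≤ y<T))
      (trans (mirror-parity h y<T) (parity-suc y))
      (trans (interchange (α T) _ _ _) (trans
        (cong ((α T + α 0) +_) (trans (proj₂ β-mirror y (<⇒≤ y<T)) (sym (proj₂ β-mirror (suc y) y<T))))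
        (interchange (α T) (α 0) _ _)))

-- Equivalences and counting

IsPerm-∘ : ∀ {n p q} → IsPerm n p → IsPerm n q → IsPerm n (p ∘ q)
IsPerm-∘ P Q = record
  { bounded   = λ i< → bounded P (bounded Q i<)
  ; injective = λ i< j< eq → injective Q i< j< (injective P (bounded Q i<) (bounded Q j<) eq)
  }

-- Adding a constant keeps a function increasing, so `increasing-unique` identifies the shifted
-- functions. Comparing them at 0 shows that `k` equals `l`; then `f` and `g` agree, and injectivity
-- gives `p` and `q`.
align : ∀ {n f g p q k l} → 0 < n → StrictMono f → StrictMono g → f 0 ≡ g 0 →
  IsPerm n p → IsPerm n q → (∀ {i} → i < n → f (p i) + k ≡ g (q i) + l) →
  (∀ {x} → x < n → f x ≡ g x) × (∀ {i} → i < n → p i ≡ q i)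
align {n} {f} {g} {p} {q} {k} {l} 0<n f↑ g↑ f0≡g0 P Q eq = f≡g , p≡q
  where
  shifted : ∀ {x} → x < n → f x + k ≡ g x + l
  shifted = increasing-unique {f = λ x → f x + k} {g = λ x → g x + l}
    (λ x<y → +-monoˡ-< k (f↑ x<y)) (λ x<y → +-monoˡ-< l (g↑ x<y)) P Q eq
  k≡l : k ≡ l
  k≡l = +-cancelˡ-≡ (g 0) k l (trans (cong (_+ k) (sym f0≡g0)) (shifted 0<n))
  f≡g : ∀ {x} → x < n → f x ≡ g x
  f≡g {x} x<n = +-cancelʳ-≡ k (f x) (g x) (trans (shifted x<n) (cong (g x +_) (sym k≡l)))
  p≡q : ∀ {i} → i < n → p i ≡ q i
  p≡q {i} i<n = StrictMono⇒injective g↑ (trans (sym (f≡g (bounded P i<n)))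
    (+-cancelʳ-≡ k _ _ (trans (eq i<n) (cong (g (q i) +_) (sym k≡l)))))

-- Symmetries as signed coordinate maps

module Symmetry (T : ℕ) where

  mirror : Bool → ℕ → ℕ
  mirror false x = x
  mirror true  x = T ∸ x

  mirror≤ : ∀ c {x} → x ≤ T → mirror c x ≤ T
  mirror≤ false x≤ = x≤
  mirror≤ true  {x} _ = m∸n≤m T x

  mirror-isPerm : ∀ c → IsPerm (suc T) (mirror c)
  mirror-isPerm c = record
    { bounded = λ x< → s≤s (mirror≤ c (s≤s⁻¹ x<)) ; injective = λ x< y< → inj c (s≤s⁻¹ x<) (s≤s⁻¹ y<) }
    where
    inj : ∀ c {x y} → x ≤ T → y ≤ T → mirror c x ≡ mirror c y → x ≡ y
    inj false _  _  eq = eq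
    inj true  x≤ y≤ eq = ∸-cancelˡ-≡ x≤ y≤ eq

  mirror-not : ∀ c {x} → x ≤ T → suc T + 1 ∸ suc (mirror c x) ≡ suc (mirror (not c) x)
  mirror-not c {x} x≤ = trans (trans (cong (_∸ mirror c x) (+-comm T 1)) (+-∸-assoc 1 (mirror≤ c x≤)))
    (cong suc (flip c))
    where
    flip : ∀ c → T ∸ mirror c x ≡ mirror (not c) x
    flip false = refl
    flip true  = m∸[m∸n]≡n x≤

  -- `Crossed` also exchanges the coordinates. In both, the flag `c` belongs to `x` and the flag `d`
  -- to `y`.
  Straight Crossed : Bool → Bool → (ℕ × ℕ → ℕ × ℕ) → Set
  Straight c d φ = ∀ {x y} → x ≤ T → y ≤ T → φ (suc x , suc y) ≡ (suc (mirror c x) , suc (mirror d y))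
  Crossed  c d φ = ∀ {x y} → x ≤ T → y ≤ T → φ (suc x , suc y) ≡ (suc (mirror d y) , suc (mirror c x))

  Signed : (ℕ × ℕ → ℕ × ℕ) → Set
  Signed φ = ∃ λ c → ∃ λ d → Straight c d φ ⊎ Crossed c d φ

  -- The rotation exchanges the coordinates and reflects the one that was second, so it toggles
  -- between the two forms and flips one flag.
  rot-signed : ∀ {φ} → Signed φ → Signed (rot (suc T) ∘ φ)
  rot-signed (c , d , inj₁ st) = c , not d , inj₂ λ {x} x≤ y≤ →
    trans (cong (rot (suc T)) (st x≤ y≤)) (cong (_, suc (mirror c x)) (mirror-not d y≤))
  rot-signed (c , d , inj₂ cr) = not c , d , inj₁ λ {_} {y} x≤ y≤ →
    trans (cong (rot (suc T)) (cr x≤ y≤)) (cong (_, suc (mirror d y)) (mirror-not c x≤))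

  rotPow-signed : ∀ k {φ} → Signed φ → Signed (rotPow (suc T) k ∘ φ)
  rotPow-signed zero    sg = sg
  rotPow-signed (suc k) {φ} sg = rot-signed {rotPow (suc T) k ∘ φ} (rotPow-signed k {φ} sg)

  sym-signed : ∀ g → Signed (Defs.sym (suc T) g)
  sym-signed (k , false) = rotPow-signed (toℕ k) {λ v → v} (false , false , inj₁ λ _ _ → refl)
  sym-signed (k , true)  = rotPow-signed (toℕ k) {Defs.refl (suc T)}
    (false , true , inj₁ λ {x} _ y≤ → cong (suc x ,_) (mirror-not false y≤))

-- `label` is injective for a fixed parity `p`, so equal labels come from equal values.
values-agree : ∀ {h α β α′ β′} (G : Grid h α β) (G′ : Grid h α′ β′) p {i j x y x′ y′} →
  let m = suc (h + h) in x < m → y < m → x′ < m → y′ < m → i ≡ suc x → j ≡ suc y →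
  at (Grid.labeling G′ p) (suc x′) (suc y′) ≡ at (Grid.labeling G p) i j →
  α′ x′ + β′ y′ ≡ α x + β y
values-agree {h} {α} {β} {α′} {β′} G G′ p {i} {j} {x} {y} {x′} {y′} x< y< x′< y′< i≡ j≡ eq =
  label-injective {suc (h + h) * suc (h + h)} {p} {α′ x′ + β′ y′} {α x + β y}
    (Grid.value-bounded G′ x′< y′<) (Grid.value-bounded G x< y<)
    (suc-injective (trans (sym (Grid.at-labeling G′ p refl refl x′< y′<))
      (trans eq (Grid.at-labeling G p i≡ j≡ x< y<))))

-- The family of labelings and its inequivalence

module Family (h : ℕ) where

  private
    H = suc h
    T = H + H
    m = width h

  open Symmetry T

  grid : ∀ {xs} → IsProjFactSeq m m xs → (a b : Arrangement h) → Grid H (rowVal xs ∘ arrange a) (colVal xs ∘ arrange b)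
  grid {xs} (_ , ge , evens≡m , odds≡m) a b = record
    { value-bounded   = λ {i} {j} i< j< → subst₂ (λ s t → rowVal xs (arrange a i) + colVal xs (arrange b j) < s * t) evens≡m odds≡m
        (val-bound ge (row< a i<) (col< b j<))
    ; value-injective = λ i< i′< j< j′< eq →
        let p≡ , q≡ = val-injective ge (row< a i<) (row< a i′<) (col< b j<) (col< b j′<) eq
        in injective (arrange-isPerm a) i< i′< p≡ , injective (arrange-isPerm b) j< j′< q≡
    -- The constant is the value at the last index `T`: arranged mirror images sum to `T`, and their
    -- values add without carries.
    ; α-mirror        = rowVal xs T , λ i i≤ → let s = arrange-mirror a i (T ∸ i) (m+[n∸m]≡n i≤) in
        trans (rowVal-mirror ge _ _ (trans (cong suc s) (sym evens≡m))) (cong (rowVal xs) s)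
    ; β-mirror        = colVal xs T , λ i i≤ → let s = arrange-mirror b i (T ∸ i) (m+[n∸m]≡n i≤) in
        trans (colVal-mirror ge _ _ (trans (cong suc s) (sym odds≡m))) (cong (colVal xs) s)
    ; α-parity        = λ i< → trans (rowVal-parity allOdd _) (arrange-parity a i<)
    ; β-parity        = λ i< → trans (colVal-parity allOdd _) (arrange-parity b i<)
    }
    where
    row< : ∀ a {i} → i < m → arrange a i < product (evens xs)
    row< a i< = subst (_ <_) (sym evens≡m) (bounded (arrange-isPerm a) i<)
    col< : ∀ a {i} → i < m → arrange a i < product (odds xs)
    col< a i< = subst (_ <_) (sym odds≡m) (bounded (arrange-isPerm a) i<)
    odd-m : Odd m
    odd-m = trans (parity-suc T) (cong ℙ._⁻¹ (parity-double H))
    allOdd : All Odd xs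
    allOdd = odd-entries xs (subst Odd (sym evens≡m) odd-m) (subst Odd (sym odds≡m) odd-m)

  labelingOf : Parity → ∀ {xs} → IsProjFactSeq m m xs → (a b : Arrangement h) → Labeling m m
  labelingOf p F a b = Grid.labeling (grid F a b) p

  module _ (p : Parity) {xs xs′ : List ℕ} (F : IsProjFactSeq m m xs) (F′ : IsProjFactSeq m m xs′)
           (a b a′ b′ : Arrangement h) where

    private
      ge : AllGE2 xs
      ge = proj₁ (proj₂ F)
      ge′ : AllGE2 xs′
      ge′ = proj₁ (proj₂ F′)
      evens≡ : ∀ {ys} → IsProjFactSeq m m ys → product (evens ys) ≡ m
      evens≡ G = proj₁ (proj₂ (proj₂ G))
      odds≡ : ∀ {ys} → IsProjFactSeq m m ys → product (odds ys) ≡ m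
      odds≡ G = proj₂ (proj₂ (proj₂ G))

    -- Allowing an arbitrary vertex map `φ` makes it possible to argue from the signed form of a
    -- symmetry alone.
    EquivalentVia : (ℕ × ℕ → ℕ × ℕ) → Set
    EquivalentVia φ = ∀ i j → 1 ≤ i → i ≤ m → 1 ≤ j → j ≤ m →
      at (labelingOf p F′ a′ b′) i j ≡ at (labelingOf p F a b) (proj₁ (φ (i , j))) (proj₂ (φ (i , j)))

    unmirrored : ∀ c (a a′ : Arrangement h) → (∀ {i} → i < m → arrange a′ i ≡ arrange a (mirror c i)) → a ≡ a′
    unmirrored false a a′ eq = arrange-unique a a′ (λ i< → sym (eq i<))
    unmirrored true  a a′ eq = ⊥-elim (arrange-not-mirrored a′ a eq)

    -- With one coordinate frozen at 0 its contribution is a constant, so `align` treats rows and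
    -- columns separately. The enumerations yield the sequence by `vals-determine`, the permutations
    -- yield the arrangements by `unmirrored`.
    straight-equivalence : ∀ {φ} c d → Straight c d φ → EquivalentVia φ → xs ≡ xs′ × a ≡ a′ × b ≡ b′
    straight-equivalence {φ} c d straight equiv =
      xs≡xs′ , unmirrored c a a′ (proj₂ rows) , unmirrored d b b′ (proj₂ cols)
      where
      values : ∀ {x y} → x < m → y < m →
        rowVal xs′ (arrange a′ x) + colVal xs′ (arrange b′ y) ≡
        rowVal xs (arrange a (mirror c x)) + colVal xs (arrange b (mirror d y))
      values {x} {y} x< y< = values-agree (grid F a b) (grid F′ a′ b′) p
        (bounded (mirror-isPerm c) x<) (bounded (mirror-isPerm d) y<) x< y<
        (cong proj₁ form) (cong proj₂ form) (equiv (suc x) (suc y) (s≤s z≤n) x< (s≤s z≤n) y<)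
        where
        form : φ (suc x , suc y) ≡ (suc (mirror c x) , suc (mirror d y))
        form = straight (s≤s⁻¹ x<) (s≤s⁻¹ y<)
      rows : (∀ {x} → x < m → rowVal xs′ x ≡ rowVal xs x) × (∀ {i} → i < m → arrange a′ i ≡ arrange a (mirror c i))
      rows = align {m} {rowVal xs′} {rowVal xs} {arrange a′} {arrange a ∘ mirror c}
        {colVal xs′ (arrange b′ 0)} {colVal xs (arrange b (mirror d 0))}
        z<s (rowVal-mono ge′) (rowVal-mono ge) (trans (rowVal-0 xs′) (sym (rowVal-0 xs)))
        (arrange-isPerm a′) (IsPerm-∘ (arrange-isPerm a) (mirror-isPerm c)) (λ x< → values x< z<s)
      cols : (∀ {x} → x < m → colVal xs′ x ≡ colVal xs x) × (∀ {i} → i < m → arrange b′ i ≡ arrange b (mirror d i))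
      cols = align {m} {colVal xs′} {colVal xs} {arrange b′} {arrange b ∘ mirror d}
        {rowVal xs′ (arrange a′ 0)} {rowVal xs (arrange a (mirror c 0))}
        z<s (colVal-mono ge′) (colVal-mono ge) (trans (colVal-0 xs′) (sym (colVal-0 xs)))
        (arrange-isPerm b′) (IsPerm-∘ (arrange-isPerm b) (mirror-isPerm d))
        (λ {y} y< → trans (+-comm (colVal xs′ (arrange b′ y)) _) (trans (values z<s y<)
          (+-comm (rowVal xs (arrange a (mirror c 0))) _)))
      xs≡xs′ : xs ≡ xs′
      xs≡xs′ = vals-determine ge ge′ (trans (evens≡ F) (sym (evens≡ F′))) (trans (odds≡ F) (sym (odds≡ F′)))
        (λ k k< → sym (proj₁ rows (subst (k <_) (evens≡ F) k<)))
        (λ k k< → sym (proj₁ cols (subst (k <_) (odds≡ F) k<)))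

    -- A crossed symmetry would identify the row values of xs′ with the column
    -- values of xs, but 1 is always a row value and never a column value.
    ¬crossed-equivalence : ∀ {φ} c d → Crossed c d φ → ¬ EquivalentVia φ
    ¬crossed-equivalence {φ} c d crossed equiv = one-differs F ge (rows (s≤s z<s))
      where
      values : ∀ {x y} → x < m → y < m →
        rowVal xs′ (arrange a′ x) + colVal xs′ (arrange b′ y) ≡
        rowVal xs (arrange a (mirror d y)) + colVal xs (arrange b (mirror c x))
      values {x} {y} x< y< = values-agree (grid F a b) (grid F′ a′ b′) p
        (bounded (mirror-isPerm d) y<) (bounded (mirror-isPerm c) x<) x< y<
        (cong proj₁ form) (cong proj₂ form) (equiv (suc x) (suc y) (s≤s z≤n) x< (s≤s z≤n) y<)
        where
        form : φ (suc x , suc y) ≡ (suc (mirror d y) , suc (mirror c x))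
        form = crossed (s≤s⁻¹ x<) (s≤s⁻¹ y<)
      rows : ∀ {x} → x < m → rowVal xs′ x ≡ colVal xs x
      rows = proj₁ (align {m} {rowVal xs′} {colVal xs} {arrange a′} {arrange b ∘ mirror c}
        {colVal xs′ (arrange b′ 0)} {rowVal xs (arrange a (mirror d 0))}
        z<s (rowVal-mono ge′) (colVal-mono ge) (trans (rowVal-0 xs′) (sym (colVal-0 xs)))
        (arrange-isPerm a′) (IsPerm-∘ (arrange-isPerm b) (mirror-isPerm c))
        (λ {x} x< → trans (values x< z<s) (+-comm (rowVal xs (arrange a (mirror d 0))) _)))
      one-differs : ∀ {xs} → IsProjFactSeq m m xs → AllGE2 xs → rowVal xs′ 1 ≢ colVal xs 1
      one-differs {[]}     (() , _) _
      one-differs {x ∷ xs} _ (2≤x ∷ ge) eq =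
        <⇒≢ 2≤x (trans (sym (rowVal-1 ge′)) (trans eq (colVal-1 {x} ge)))

    signed-equivalence : ∀ {φ} → Signed φ → EquivalentVia φ → xs ≡ xs′ × a ≡ a′ × b ≡ b′
    signed-equivalence {φ} (c , d , inj₁ straight) equiv = straight-equivalence {φ} c d straight equiv
    signed-equivalence {φ} (c , d , inj₂ crossed)  equiv = contradiction equiv (¬crossed-equivalence {φ} c d crossed)

    labelingOf-injective : Equivalent (labelingOf p F a b) (labelingOf p F′ a′ b′) → xs ≡ xs′ × a ≡ a′ × b ≡ b′
    labelingOf-injective (g , equiv) = signed-equivalence {Defs.sym m g} (sym-signed g) equiv

-- Counting the family

vec-count : ∀ n → Fin (2 ^ n) ↣ Vec Bool n
vec-count zero    = mk↣ {to = λ _ → []} λ { {Fin.zero} {Fin.zero} _ → refl }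
vec-count (suc n) = cons ↣-∘ ((↔⇒↣ Fin.2↔Bool ×-↣ vec-count n) ↣-∘ ↔⇒↣ Fin.*↔×)
  where
  cons : (Bool × Vec Bool n) ↣ Vec Bool (suc n)
  cons = mk↣ {to = λ (b , bs) → b ∷ bs} λ { refl → refl }

-- Passing from `h` to `suc h` multiplies the count by the `suc ⌊ h /2⌋` choices of a partner. The
-- old ceiling becomes the new floor and the new ceiling is `suc ⌊ h /2⌋`, so the two factorials
-- trade places.
code-count : ∀ h → Fin (⌊ h /2⌋ ! * ⌈ h /2⌉ !) ↣ Code h
code-count zero    = mk↣ {to = λ _ → tt} λ { {Fin.zero} {Fin.zero} _ → refl }
code-count (suc h) = subst (λ n → Fin n ↣ Code (suc h)) (reorder ⌊ h /2⌋ (⌊ h /2⌋ !) (⌈ h /2⌉ !))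
  ((↣-id _ ×-↣ code-count h) ↣-∘ ↔⇒↣ Fin.*↔×)
  where
  reorder : ∀ k a b → suc k * (a * b) ≡ b * (suc k * a)
  reorder = solve-∀

arrangement-count : ∀ h → Fin (2 ^ h * (⌊ suc h /2⌋ ! * ⌈ suc h /2⌉ !)) ↣ Arrangement h
arrangement-count h = (vec-count h ×-↣ code-count (suc h)) ↣-∘ ↔⇒↣ Fin.*↔×

β-1mod4 : ∀ w → β (1 + w * 4) ≡ w ! * w !
β-1mod4 w with (1 + w * 4) % 4 ≟ 1
... | yes _ = cong (λ t → t ! * t !) (m*n/n≡m w 4)
... | no ≢1 = contradiction ([m+kn]%n≡m%n 1 w 4) ≢1

β-3mod4 : ∀ w → β (3 + w * 4) ≡ w ! * (suc w) !
β-3mod4 w with (3 + w * 4) % 4 ≟ 1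
... | yes ≡1 = contradiction (trans (sym ≡1) ([m+kn]%n≡m%n 3 w 4)) λ ()
... | no _   = cong₂ (λ s t → s ! * t !) (m*n/n≡m w 4)
  (trans (cong (_/ 4) (+-comm (3 + w * 4) 1)) (m*n/n≡m (suc w) 4))

-- The two residues modulo 4 in `β` correspond to `k` even and `k` odd, and `w` is the argument of
-- the first factorial in both cases.
β-halves : ∀ k → β (suc (k + k)) ≡ ⌊ k /2⌋ ! * ⌈ k /2⌉ !
β-halves k with parity-cases k 0ℙ
... | inj₁ even = begin
  β (suc (k + k))               ≡⟨ cong (λ t → β (suc (t + t))) k≡ ⟩
  β (suc ((w + w) + (w + w)))   ≡⟨ cong β (four w) ⟩
  β (1 + w * 4)                 ≡⟨ β-1mod4 w ⟩
  w ! * w !                     ≡⟨ cong (λ t → w ! * t !) (trans (n≡⌈n+n/2⌉ w) (cong ⌈_/2⌉ (sym k≡))) ⟩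
  w ! * ⌈ k /2⌉ !               ∎
  where
  open ≡-Reasoning
  w = ⌊ k /2⌋
  k≡ : k ≡ w + w
  k≡ = halves k even
  four : ∀ w → suc ((w + w) + (w + w)) ≡ 1 + w * 4
  four = solve-∀
... | inj₂ odd = begin
  β (suc (k + k))                       ≡⟨ cong (λ t → β (suc (t + t))) k≡ ⟩
  β (suc (suc (w + w) + suc (w + w)))   ≡⟨ cong β (four w) ⟩
  β (3 + w * 4)                         ≡⟨ β-3mod4 w ⟩
  w ! * suc w !                         ≡⟨ cong (λ t → w ! * t !) (trans (cong suc (n≡⌊n+n/2⌋ w)) (cong ⌈_/2⌉ (sym k≡))) ⟩
  w ! * ⌈ k /2⌉ !                       ∎
  where
  open ≡-Reasoning
  w = ⌊ k /2⌋
  k≡ : k ≡ suc (w + w)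
  k≡ = halves k odd
  four : ∀ w → suc (suc (w + w) + suc (w + w)) ≡ 3 + w * 4
  four = solve-∀

lookup-injective : ∀ {A : Set} {xs : List A} → Unique xs → ∀ {i j} → lookup xs i ≡ lookup xs j → i ≡ j
lookup-injective (_ ∷ _)  {Fin.zero}  {Fin.zero}  _  = refl
lookup-injective (px ∷ _) {Fin.zero}  {Fin.suc j} eq = contradiction eq (All.lookup px (∈-lookup j))
lookup-injective (px ∷ _) {Fin.suc i} {Fin.zero}  eq = contradiction (sym eq) (All.lookup px (∈-lookup i))
lookup-injective (_ ∷ u)  {Fin.suc i} {Fin.suc j} eq = cong Fin.suc (lookup-injective u eq)

-- As `width h` is `2h + 3`, the power of 2 splits into one factor `2 ^ h` for each of the two
-- arrangements.
index-count : ∀ l h → Fin (l * 2 ^ (width h ∸ 3) * (β (width h) * β (width h))) ↣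
  (Fin l × Arrangement h × Arrangement h)
index-count l h = subst (λ n → Fin n ↣ (Fin l × Arrangement h × Arrangement h)) (sym size)
  ((↣-id _ ×-↣ ((arrangement-count h ×-↣ arrangement-count h) ↣-∘ ↔⇒↣ Fin.*↔×)) ↣-∘ ↔⇒↣ Fin.*↔×)
  where
  K = ⌊ suc h /2⌋ ! * ⌈ suc h /2⌉ !
  reorder : ∀ l t k → l * (t * t) * (k * k) ≡ l * ((t * k) * (t * k))
  reorder = solve-∀
  size : l * 2 ^ (width h ∸ 3) * (β (width h) * β (width h)) ≡ l * ((2 ^ h * K) * (2 ^ h * K))
  size = begin
    l * 2 ^ (width h ∸ 3) * (β (width h) * β (width h))
      ≡⟨ cong₂ (λ e b → l * 2 ^ e * (b * b)) (cong (_∸ 1) (+-suc h h)) (β-halves (suc h)) ⟩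
    l * 2 ^ (h + h) * (K * K)            ≡⟨ cong (λ t → l * t * (K * K)) (^-distribˡ-+-* 2 h h) ⟩
    l * (2 ^ h * 2 ^ h) * (K * K)        ≡⟨ reorder l (2 ^ h) K ⟩
    l * ((2 ^ h * K) * (2 ^ h * K))      ∎
    where open ≡-Reasoning

odd⇒width : ∀ {m} → 3 ≤ m → m % 2 ≡ 1 → ∃ λ h → m ≡ width h
odd⇒width {m} 3≤m odd with m / 2 | trans (m≡m%n+[m/n]*n m 2) (cong (_+ m / 2 * 2) odd)
-- Quotient 0 would mean `m = 1`.
... | zero  | refl = contradiction 3≤m λ { (s≤s ()) }
... | suc h | eq   = h , trans eq (double h)
  where
  double : ∀ h → 1 + suc h * 2 ≡ suc (suc h + suc h)
  double = solve-∀

labelings : ∀ h (ts : List (List ℕ)) → Unique ts → (∀ xs → xs ∈ ts ⇔ IsProjFactSeq (width h) (width h) xs) →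
  ∀ p → Σ (Fin (length ts * 2 ^ (width h ∸ 3) * (β (width h) * β (width h))) → Labeling (width h) (width h)) λ Ls →
    (∀ a → FaceMagic (Ls a) (magicValue (width h * width h) p))
    × (∀ a b → a ≢ b → ¬ Equivalent (Ls a) (Ls b))
labelings h ts unique complete p = Ls , magic , inequivalent
  where
  open Family h
  open Injection (index-count (length ts) h) using () renaming (to to index; injective to index-injective)
  factorization : ∀ i → IsProjFactSeq (width h) (width h) (lookup ts i)
  factorization i = Equivalence.to (complete (lookup ts i)) (∈-lookup i)
  L : Fin (length ts) × Arrangement h × Arrangement h → Labeling (width h) (width h)
  L (i , a , b) = labelingOf p (factorization i) a b
  Ls = λ n → L (index n)
  magic : ∀ n → FaceMagic (Ls n) (magicValue (width h * width h) p)
  magic n = let i , a , b = index n in Grid.labeling-magic (grid (factorization i) a b) p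
  L-injective : ∀ x y → Equivalent (L x) (L y) → x ≡ y
  L-injective (i , a , b) (i′ , a′ , b′) equiv =
    let xs≡ , a≡ , b≡ = labelingOf-injective p (factorization i) (factorization i′) a b a′ b′ equiv
    in cong₂ _,_ (lookup-injective unique xs≡) (cong₂ _,_ a≡ b≡)
  inequivalent : ∀ n n′ → n ≢ n′ → ¬ Equivalent (Ls n) (Ls n′)
  inequivalent n n′ n≢n′ equiv = n≢n′ (index-injective (L-injective (index n) (index n′) equiv))

theorem43 : (m : ℕ) → 3 ≤ m → m % 2 ≡ 1 →
    (ts : List (List ℕ)) → Unique ts → (∀ xs → xs ∈ ts ⇔ IsProjFactSeq m m xs) →
    (s : ℕ) → s ≡ 2 * (m * m) + 1 ⊎ s ≡ 2 * (m * m) + 3 →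
    Σ (Fin (length ts * 2 ^ (m ∸ 3) * (β m * β m)) → Labeling m m) λ Ls →
    (∀ a → FaceMagic (Ls a) s)
    × (∀ a b → a ≢ b → ¬ Equivalent (Ls a) (Ls b))
theorem43 m 3≤m odd ts unique complete s s≡ with odd⇒width 3≤m odd
-- The smaller magic value belongs to `1ℙ`, where the odd values receive the small labels.
theorem43 _ _ _ ts unique complete _ (inj₁ refl) | h , refl = labelings h ts unique complete 1ℙ
theorem43 _ _ _ ts unique complete _ (inj₂ refl) | h , refl = labelings h ts unique complete 0ℙ
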